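{- Let $\mathcal F$ be a finite family of connected bounded open sets in $\mathbb R^2$, and let $n\le m$ be positive integers. Then at least one of the following holds. (1) $\mathcal F$ can be cut by a family consisting of $m$ horizontal and $n$ vertical lines. (2) For any $n+1$ positive integers $a_1,\ldots,a_n,a_{n+1}$ with $\sum_{i=1}^{n+1}a_i=m+1$ there exist a subfamily $\{X_1,\ldots,X_{m+1}\}\subseteq\mathcal F$ and a map $\sigma:[m+1]\to[n+1]$ such that: $|\sigma^{ -1}(i)|=a_i$ for all $i\in[n+1]$; the projections of $X_i$ and $X_j$ to the $y$ axis do not intersect whenever $i\neq j$; and the projections of $X_i$ and $X_j$ to the $x$ axis do not intersect whenever $\sigma(i)\neq\sigma(j)$.
   Context: $[n]=\{1,2,\ldots,n\}$. A family $\mathcal L$ of lines in $\mathbb R^2$ cuts a family $\mathcal F$ of subsets of $\mathbb R^2$ if for every $F\in\mathcal F$ there is some $l\in\mathcal L$ with $F\cap l\neq\emptyset$. A coordinate system in $\mathbb R^2$ is fixed; a line is horizontal if it is parallel to the $x$ axis and vertical if it is parallel to the $y$ axis. Connected sets are understood to be nonempty. -}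

module Defs where

open import Data.Fin.Base using (Fin)
open import Data.Fin.Properties using (_≟_)
open import Data.Fin.Subset using (Subset)
open import Data.Product.Base using (∃; ∃₂; _×_; _,_)
open import Data.Rational.Base as ℚ using (ℚ)
open import Data.Vec.Base using (tabulate)
open import Level using (Level; Lift; 0ℓ; suc)
open import Relation.Nullary using (¬_; does)
open import Relation.Unary

private
  variable
    i j : Level

-- One-sided Dedekind cuts: nonempty proper initial segments of ℚ without a
-- greatest element. They are only used together with excluded middle, which
-- makes them the usual real numbers.

record ℝ : Set₁ where
  field
    lower     : Pred ℚ 0ℓ
    inhabited : ∃ λ q → q ∈ lower
    proper    : ∃ λ q → q ∉ lower
    closed    : ∀ {p q} → p ℚ.< q → q ∈ lower → p ∈ lower
    rounded   : ∀ {p} → p ∈ lower → ∃ λ q → p ℚ.< q × q ∈ lower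

open ℝ public

infix 4 _≈_ _<_

_≈_ : ℝ → ℝ → Set
x ≈ y = lower x ≐ lower y

_<_ : ℝ → ℝ → Set
x < y = ∃ λ q → q ∈ lower y × q ∉ lower x

ℝ² : Set₁
ℝ² = ℝ × ℝ

-- Level 1 is the level of predicates that quantify over ℝ, such as the
-- projections below. Open sets automatically respect _≈_, because boxes do.

PlaneSet : Set₂
PlaneSet = Pred ℝ² (suc 0ℓ)

⦅_,_⦆ : ℝ → ℝ → Pred ℝ 0ℓ
⦅ a , b ⦆ x = a < x × x < b

openBox : ℝ² → ℝ² → Pred ℝ² 0ℓ
openBox (a , c) (b , d) = ⦅ a , b ⦆ ⟨×⟩ ⦅ c , d ⦆

IsOpen : PlaneSet → Set₁
IsOpen U = ∀ {p} → p ∈ U → ∃₂ λ a b → p ∈ openBox a b × openBox a b ⊆ U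

IsBounded : PlaneSet → Set₁
IsBounded S = ∃₂ λ a b → S ⊆ openBox a b

IsConnected : PlaneSet → Set₂
IsConnected S =
  Satisfiable S ×
  (∀ (U V : PlaneSet) → IsOpen U → IsOpen V →
     S ⊆ U ∪ V → S ≬ U → S ≬ V → ¬ Empty (S ∩ U ∩ V))

horizontalLine : ℝ → PlaneSet
horizontalLine c (_ , y) = Lift (suc 0ℓ) (y ≈ c)

verticalLine : ℝ → PlaneSet
verticalLine c (x , _) = Lift (suc 0ℓ) (x ≈ c)

_Cuts_ : {I : Set i} {J : Set j} → (I → PlaneSet) → (J → PlaneSet) → Set _
𝓛 Cuts 𝓕 = ∀ k → ∃ λ l → 𝓕 k ≬ 𝓛 l

xProjection : PlaneSet → Pred ℝ (suc 0ℓ)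
xProjection S x = ∃ λ y → (x , y) ∈ S

yProjection : PlaneSet → Pred ℝ (suc 0ℓ)
yProjection S y = ∃ λ x → (x , y) ∈ S

fibre : ∀ {m n} → (Fin m → Fin n) → Fin n → Subset m
fibre σ c = tabulate λ k → does (σ k ≟ c)

{-# OPTIONS --safe #-}

-- Whether a line meets a connected open set depends only on a projection of the
-- set, an interval; so lines may be restricted to a finite grid that contains two
-- consecutive points of every nonempty intersection of two projections.
--
-- Let the positions of m horizontal and n vertical lines range over the cube
-- {0,…,N}^(n+m) in Kuhn's triangulation. If no choice of lines cuts 𝓕, label each
-- vertex (i , j) when some uncut set lies in the i-th horizontal and the j-th
-- vertical strip. A simplex is good if its m + n + 1 labels are the edges of a
-- spanning tree of K_{m+1,n+1} in which the degrees of the columns are prescribed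
-- by a. Directing all edges away from one column, each other column receives one
-- edge, and the remaining edges pick one column for every row, a_j of them in
-- column j. Vertices of one simplex differ by at most one in each coordinate, so
-- the sets chosen at the corresponding vertices are as required.
--
-- That the number of good simplices is odd is a Sperner-type argument: being a
-- spanning tree is a determinant over 𝔽₂ in the row and column indicators, so the
-- indicator of good simplices is the coboundary of the analogous one for the face
-- on which the last line is at N, and Stokes' theorem lowers the dimension.
module Submission where

import Algebra.Properties.CommutativeSemigroup as CommutativeSemigroupProperties
open import Algebra.Bundles using (CommutativeRing)
open import Axiom.ExcludedMiddle using (ExcludedMiddle)
open import Data.Bool.Base using (Bool; true; false; _∧_; _xor_)
open import Data.Bool.Properties
  using ( xor-assoc; xor-comm; xor-same; xor-identityʳ; ∧-zeroʳ; ∧-distribˡ-xor; ∧-distribʳ-xor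
        ; xor-∧-commutativeRing)
open import Data.Fin.Base as Fin using (Fin; toℕ; fromℕ<)
import Data.Fin.Properties as Finₚ
open import Data.Fin.Subset using (∣_∣)
open import Data.List.Base as List
  using ( List; []; _∷_; _++_; map; null; downFrom; filter; length; replicate; concatMap; allFin)
open import Data.List.Membership.Propositional using (_∈_; _∉_; lose)
open import Data.List.Membership.Propositional.Properties
  using ( ∈-downFrom⁺; ∈-downFrom⁻; ∈-map⁺; ∈-map⁻; ∈-++⁺ˡ; ∈-++⁺ʳ; ∈-filter⁺; ∈-concatMap⁺
        ; ∈-allFin; ∈-lookup)
open import Data.List.Properties
  using ( map-∘; map-++; map-cong; length-map; length-++; length-replicate; length-downFrom
        ; filter-all; filter-none; filter-accept; filter-reject; filter-++)
open import Data.List.Relation.Binary.Permutation.Propositional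
  using ( _↭_; refl; prep; swap; ↭-sym; ↭-trans; ↭-prep; ↭-reflexive; ↭⇒↭ₛ
        ; module PermutationReasoning)
  renaming (trans to transᵖ)
open import Data.List.Relation.Binary.Permutation.Propositional.Properties
  using (All-resp-↭; ∈-resp-↭; drop-∷; map⁺; ++⁺ˡ; ++-comm; shift; filter-↭; ↭-length)
import Data.List.Relation.Binary.Permutation.Setoid.Properties as Permutationₛ
open import Data.List.Relation.Binary.Pointwise.Base using (Pointwise; []; _∷_)
open import Data.List.Relation.Unary.All as All using (All; []; _∷_)
open import Data.List.Relation.Unary.All.Properties using (All¬⇒¬Any)
  renaming (map⁺ to All-map⁺; ++⁺ to All-++⁺; replicate⁺ to All-replicate⁺)
open import Data.List.Relation.Unary.AllPairs using (AllPairs; []; _∷_)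
open import Data.List.Relation.Unary.Any using (here; there)
open import Data.List.Relation.Unary.Linked.Properties using (Linked⇒AllPairs)
open import Data.List.Relation.Unary.Unique.Propositional using (Unique)
open import Data.List.Relation.Unary.Unique.Propositional.Properties using (downFrom⁺)
open import Data.Nat.Base using (ℕ; zero; suc; _+_; _∸_; _≤_; z≤n; s≤s; z<s)
  renaming (_<_ to _<ᴺ_)
open import Data.Nat.ListAction using () renaming (sum to sumᴸ)
open import Data.Nat.ListAction.Properties using (sum-↭)
open import Data.Nat.Properties
open import Data.Product.Base using (∃; ∃₂; _×_; _,_; proj₁; proj₂) renaming (swap to ×-swap)
open import Data.Rational.Base as ℚ using (ℚ; 0ℚ; 1ℚ; _⊔_)
import Data.Rational.Properties as ℚₚ
open import Data.List.Sort ℚₚ.≤-decTotalOrder using (sort; sort-↭; sort-↗)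
open import Data.Sum.Base using (_⊎_; inj₁; inj₂; [_,_]′)
open import Data.Vec.Base using (Vec; []; _∷_; lookup; sum)
open import Function.Base using (_∘_; id)
open import Level using (Level; Lift; lift; 0ℓ)
open import Relation.Binary.Definitions using (tri<; tri≈; tri>)
open import Relation.Binary.PropositionalEquality
  using (_≡_; _≢_; refl; sym; trans; cong; cong₂; subst; module ≡-Reasoning)
import Relation.Binary.PropositionalEquality.Properties as ≡
open import Relation.Nullary using (¬_; ¬?; Dec; yes; no; does; contradiction)
open import Relation.Nullary.Decidable using (dec-true; dec-false; decidable-stable)
open import Relation.Unary using (Pred; _∪_; _≬_; _⊥_)
open import Defs

open CommutativeSemigroupProperties (CommutativeRing.+-commutativeSemigroup xor-∧-commutativeRing)
  using () renaming (interchange to xor-interchange)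
open CommutativeSemigroupProperties (CommutativeRing.*-commutativeSemigroup xor-∧-commutativeRing)
  using () renaming (x∙yz≈y∙xz to ∧-swap)

private
  variable
    ℓ : Level
    A B : Set ℓ
    t : ℕ

-- Sums over 𝔽₂ that take elements out of a list.

xor-cancelˡ : ∀ a b → a xor (a xor b) ≡ b
xor-cancelˡ a b = trans (sym (xor-assoc a a b)) (cong (_xor b) (xor-same a))

-- The sum over 𝔽₂ of f x ys over all ways to take one element x out of a list,
-- leaving ys.
pick : (A → List A → Bool) → List A → Bool
pick f []       = false
pick f (x ∷ xs) = f x xs xor pick (λ y ys → f y (x ∷ ys)) xs

-- Equality is asked only for genuine splittings of `xs`, so that facts about its members can be
-- passed on to `y` and `ys`.
pick-cong : ∀ {f g : A → List A → Bool} xs →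
  (∀ y ys → y ∷ ys ↭ xs → f y ys ≡ g y ys) → pick f xs ≡ pick g xs
pick-cong []       eq = refl
pick-cong (x ∷ xs) eq = cong₂ _xor_ (eq x xs refl)
  (pick-cong xs λ y ys p → eq y (x ∷ ys) (↭-trans (swap y x refl) (prep x p)))

pick-false : ∀ {f : A → List A → Bool} xs →
  (∀ y ys → y ∷ ys ↭ xs → f y ys ≡ false) → pick f xs ≡ false
pick-false xs eq = trans (pick-cong xs eq) (go xs)
  where
  go : ∀ xs → pick (λ _ _ → false) xs ≡ false
  go []       = refl
  go (_ ∷ xs) = go xs

pick-xor : ∀ (f g : A → List A → Bool) xs →
  pick (λ y ys → f y ys xor g y ys) xs ≡ pick f xs xor pick g xs
pick-xor f g []       = refl
pick-xor f g (x ∷ xs) = trans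
  (cong ((f x xs xor g x xs) xor_) (pick-xor (λ y ys → f y (x ∷ ys)) (λ y ys → g y (x ∷ ys)) xs))
  (xor-interchange (f x xs) (g x xs) _ _)

pick-∧ : ∀ a (f : A → List A → Bool) xs → a ∧ pick f xs ≡ pick (λ y ys → a ∧ f y ys) xs
pick-∧ a f []       = ∧-zeroʳ a
pick-∧ a f (x ∷ xs) = trans (∧-distribˡ-xor a (f x xs) _)
  (cong ((a ∧ f x xs) xor_) (pick-∧ a (λ y ys → f y (x ∷ ys)) xs))

pick-map : ∀ (φ : A → B) (f : B → List B → Bool) xs →
  pick f (map φ xs) ≡ pick (λ y ys → f (φ y) (map φ ys)) xs
pick-map φ f []       = refl
pick-map φ f (x ∷ xs) = cong (f (φ x) (map φ xs) xor_) (pick-map φ (λ y ys → f y (φ x ∷ ys)) xs)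

pick-witness : ∀ {f : A → List A → Bool} xs → pick f xs ≡ true →
  ∃₂ λ y ys → y ∷ ys ↭ xs × f y ys ≡ true
pick-witness {f = f} (x ∷ xs) eq with f x xs in fx
... | true  = x , xs , refl , fx
... | false with pick-witness xs eq
...   | y , ys , p , fy = y , x ∷ ys , ↭-trans (swap y x refl) (prep x p) , fy

pick₂ : (A → A → List A → Bool) → List A → Bool
pick₂ F = pick λ x → pick (F x)

-- Ordered pairs are sorted by whether `x` comes first, second or not at all.
pick₂-∷ : ∀ (F : A → A → List A → Bool) x xs →
  pick₂ F (x ∷ xs) ≡ (pick (F x) xs xor pick (λ y → F y x) xs) xor pick₂ (λ y z zs → F y z (x ∷ zs)) xs
pick₂-∷ F x xs = trans
  (cong (pick (F x) xs xor_) (pick-xor (λ y → F y x) _ xs))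
  (sym (xor-assoc (pick (F x) xs) _ _))

pick₂-swap : ∀ (F : A → A → List A → Bool) xs → pick₂ F xs ≡ pick₂ (λ x y → F y x) xs
pick₂-swap F []       = refl
pick₂-swap F (x ∷ xs) = begin
  pick₂ F (x ∷ xs)
    ≡⟨ pick₂-∷ F x xs ⟩
  (pick (F x) xs xor pick (λ y → F y x) xs) xor pick₂ (λ y z zs → F y z (x ∷ zs)) xs
    ≡⟨ cong₂ _xor_ (xor-comm (pick (F x) xs) _) (pick₂-swap _ xs) ⟩
  (pick (λ y → F y x) xs xor pick (F x) xs) xor pick₂ (λ y z zs → F z y (x ∷ zs)) xs
    ≡⟨ pick₂-∷ (λ x y → F y x) x xs ⟨
  pick₂ (λ x y → F y x) (x ∷ xs) ∎
  where open ≡-Reasoning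

-- Each pair is counted in both orders, and two equal terms cancel over 𝔽₂.
pick₂-symmetric : ∀ (F : A → A → List A → Bool) → (∀ x y zs → F x y zs ≡ F y x zs) →
  ∀ xs → pick₂ F xs ≡ false
pick₂-symmetric F sF []       = refl
pick₂-symmetric F sF (x ∷ xs) = begin
  pick₂ F (x ∷ xs)
    ≡⟨ pick₂-∷ F x xs ⟩
  (pick (F x) xs xor pick (λ y → F y x) xs) xor pick₂ (λ y z zs → F y z (x ∷ zs)) xs
    ≡⟨ cong₂ (λ a b → (pick (F x) xs xor a) xor b)
         (pick-cong xs λ y ys _ → sF y x ys) (pick₂-symmetric _ (λ y z zs → sF y z (x ∷ zs)) xs) ⟩
  (pick (F x) xs xor pick (F x) xs) xor false
    ≡⟨ cong (_xor false) (xor-same (pick (F x) xs)) ⟩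
  false ∎
  where open ≡-Reasoning

-- Coboundaries and determinants over 𝔽₂.

-- The simplicial coboundary modulo 2: each term leaves out one vertex.
δ : (List A → Bool) → List A → Bool
δ g = pick λ _ → g

-- The parity of the number of bijections between Φ and S that match every
-- functional with an element on which it is true: a determinant over 𝔽₂.
wedge : List (A → Bool) → List A → Bool
wedge []      S = null S
wedge (φ ∷ Φ) S = pick (λ k S′ → φ k ∧ wedge Φ S′) S

wedge-swap : ∀ (φ ψ : A → Bool) Φ S → wedge (φ ∷ ψ ∷ Φ) S ≡ wedge (ψ ∷ φ ∷ Φ) S
wedge-swap φ ψ Φ S = begin
  wedge (φ ∷ ψ ∷ Φ) S                                ≡⟨ expand φ ψ ⟩
  pick₂ (λ x y zs → φ x ∧ (ψ y ∧ wedge Φ zs)) S      ≡⟨ pick₂-swap _ S ⟩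
  pick₂ (λ x y zs → φ y ∧ (ψ x ∧ wedge Φ zs)) S
    ≡⟨ pick-cong S (λ x xs _ → pick-cong xs λ y ys _ → ∧-swap (φ y) (ψ x) _) ⟩
  pick₂ (λ x y zs → ψ x ∧ (φ y ∧ wedge Φ zs)) S      ≡⟨ expand ψ φ ⟨
  wedge (ψ ∷ φ ∷ Φ) S                                ∎
  where
  open ≡-Reasoning
  expand : ∀ φ ψ → wedge (φ ∷ ψ ∷ Φ) S ≡ pick₂ (λ x y zs → φ x ∧ (ψ y ∧ wedge Φ zs)) S
  expand φ ψ = pick-cong S λ x xs _ → pick-∧ (φ x) _ xs

wedge-repeated : ∀ (φ : A → Bool) Φ S → wedge (φ ∷ φ ∷ Φ) S ≡ false
wedge-repeated φ Φ S = trans (pick-cong S λ x xs _ → pick-∧ (φ x) _ xs)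
  (pick₂-symmetric (λ x y zs → φ x ∧ (φ y ∧ wedge Φ zs)) (λ x y zs → ∧-swap (φ x) (φ y) _) S)

wedge-↭ : ∀ {Φ Ψ : List (A → Bool)} → Φ ↭ Ψ → ∀ S → wedge Φ S ≡ wedge Ψ S
wedge-↭ refl         S = refl
wedge-↭ (prep φ p)   S = pick-cong S λ k S′ _ → cong (φ k ∧_) (wedge-↭ p S′)
wedge-↭ (swap {ys = Ψ} φ ψ p) S = trans
  (pick-cong S λ k S′ _ → cong (φ k ∧_) (pick-cong S′ λ k′ S″ _ → cong (ψ k′ ∧_) (wedge-↭ p S″)))
  (wedge-swap φ ψ Ψ S)
wedge-↭ (transᵖ p q)  S = trans (wedge-↭ p S) (wedge-↭ q S)

wedge-∈ : ∀ {φ : A → Bool} {Φ} → φ ∈ Φ → ∀ S → wedge (φ ∷ Φ) S ≡ false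
wedge-∈ {φ = φ} {_ ∷ Φ} (here refl)  S = wedge-repeated φ Φ S
wedge-∈ {φ = φ} {ψ ∷ Φ} (there φ∈Φ) S = trans (wedge-swap φ ψ Φ S)
  (pick-false S λ k S′ _ → trans (cong (ψ k ∧_) (wedge-∈ φ∈Φ S′)) (∧-zeroʳ (ψ k)))

wedge-congˡ : ∀ {φ ψ : A → Bool} {Φ} S → All (λ k → φ k ≡ ψ k) S →
  wedge (φ ∷ Φ) S ≡ wedge (ψ ∷ Φ) S
wedge-congˡ {Φ = Φ} S eqs =
  pick-cong S λ k S′ p → cong (_∧ wedge Φ S′) (All.head (All-resp-↭ (↭-sym p) eqs))

-- An odd number of matchings is not zero; `T` lists the elements of `S` in the order in which they
-- are matched with `Φ`.
wedge-witness : ∀ (Φ : List (A → Bool)) S → wedge Φ S ≡ true →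
  ∃ λ T → T ↭ S × Pointwise (λ φ k → φ k ≡ true) Φ T
wedge-witness []      []      eq = [] , refl , []
wedge-witness (φ ∷ Φ) S       eq with pick-witness S eq
... | k , S′ , p , eq′ with φ k in φk
...   | true with wedge-witness Φ S′ eq′
...     | T , q , match = k ∷ T , ↭-trans (prep k q) p , φk ∷ match

wedge-vanish : ∀ {φ : A → Bool} {Φ} → φ ∈ Φ → ∀ S → All (λ k → φ k ≡ false) S →
  wedge Φ S ≡ false
wedge-vanish {φ = φ} {Φ} φ∈Φ S zeros with wedge Φ S in eq
... | false = refl
... | true with wedge-witness Φ S eq
...   | T , p , match = contra φ∈Φ match (All-resp-↭ (↭-sym p) zeros)
  where
  contra : ∀ {Φ T} → φ ∈ Φ → Pointwise (λ φ k → φ k ≡ true) Φ T →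
    All (λ k → φ k ≡ false) T → true ≡ false
  contra (here refl) (e ∷ _) (z ∷ _)   = trans (sym e) z
  contra (there i)   (_ ∷ es) (_ ∷ zs) = contra i es zs

total : List (A → Bool) → A → Bool
total []      k = false
total (φ ∷ Φ) k = φ k xor total Φ k

wedge-xor : ∀ (φ ψ : A → Bool) Φ S →
  wedge ((λ k → φ k xor ψ k) ∷ Φ) S ≡ wedge (φ ∷ Φ) S xor wedge (ψ ∷ Φ) S
wedge-xor φ ψ Φ S = trans
  (pick-cong S λ k S′ _ → ∧-distribʳ-xor (wedge Φ S′) (φ k) (ψ k)) (pick-xor _ _ S)

-- By multilinearity this is a sum of determinants, each with a repeated row.
wedge-total : ∀ (Ψ Φ : List (A → Bool)) → (∀ {ψ} → ψ ∈ Ψ → ψ ∈ Φ) → ∀ S →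
  wedge (total Ψ ∷ Φ) S ≡ false
wedge-total []      Φ Ψ⊆Φ S = pick-false S λ _ _ _ → refl
wedge-total (ψ ∷ Ψ) Φ Ψ⊆Φ S = trans (wedge-xor ψ (total Ψ) Φ S)
  (cong₂ _xor_ (wedge-∈ (Ψ⊆Φ (here refl)) S) (wedge-total Ψ Φ (Ψ⊆Φ ∘ there) S))

-- A row operation: adding all other rows to the first one does not change a determinant.
wedge-span : ∀ {φ ψ : A → Bool} {Φ} S → All (λ k → φ k ≡ ψ k xor total Φ k) S →
  wedge (φ ∷ Φ) S ≡ wedge (ψ ∷ Φ) S
wedge-span {ψ = ψ} {Φ} S eqs = trans (wedge-congˡ {Φ = Φ} S eqs) (trans (wedge-xor ψ (total Φ) Φ S)
  (trans (cong (wedge (ψ ∷ Φ) S xor_) (wedge-total Φ Φ id S)) (xor-identityʳ _)))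

-- Kuhn's triangulation: vertices and paths.

-- Coordinates are numbered from the right, so that adding a new coordinate in
-- front does not renumber the others.
at : Vec ℕ t → ℕ → ℕ
at []              e = 0
at {suc t} (x ∷ v) e with e ≟ t
... | yes _ = x
... | no  _ = at v e

step : ℕ → Vec ℕ t → Vec ℕ t
step         e []      = []
step {suc t} e (x ∷ v) with e ≟ t
... | yes _ = suc x ∷ v
... | no  _ = x ∷ step e v

at-top : ∀ x (v : Vec ℕ t) → at (x ∷ v) t ≡ x
at-top {t} x v with t ≟ t
... | yes _  = refl
... | no t≢t = contradiction refl t≢t

at-∷ : ∀ {e} x (v : Vec ℕ t) → e <ᴺ t → at (x ∷ v) e ≡ at v e
at-∷ {t} {e} x v e<t with e ≟ t
... | yes e≡t = contradiction e≡t (<⇒≢ e<t)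
... | no _    = refl

step-top : ∀ x (v : Vec ℕ t) → step t (x ∷ v) ≡ suc x ∷ v
step-top {t} x v with t ≟ t
... | yes _  = refl
... | no t≢t = contradiction refl t≢t

step-∷ : ∀ {e} x (v : Vec ℕ t) → e <ᴺ t → step e (x ∷ v) ≡ x ∷ step e v
step-∷ {t} {e} x v e<t with e ≟ t
... | yes e≡t = contradiction e≡t (<⇒≢ e<t)
... | no _    = refl

step-comm : ∀ e e′ (v : Vec ℕ t) → step e (step e′ v) ≡ step e′ (step e v)
step-comm         e e′ []      = refl
step-comm {suc t} e e′ (x ∷ v) with e ≟ t in p | e′ ≟ t in p′
... | yes _ | yes _ rewrite p | p′ = refl
... | yes _ | no _  rewrite p | p′ = refl
... | no _  | yes _ rewrite p | p′ = refl
... | no _  | no _  rewrite p | p′ = cong (x ∷_) (step-comm e e′ v)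

at-step-≢ : ∀ {e e′} (v : Vec ℕ t) → e′ ≢ e → at (step e v) e′ ≡ at v e′
at-step-≢ []      e′≢e = refl
at-step-≢ {suc t} {e} {e′} (x ∷ v) e′≢e with e ≟ t
at-step-≢ {suc t} {e} {e′} (x ∷ v) e′≢e | yes refl with e′ ≟ t
... | yes refl = contradiction refl e′≢e
... | no _     = refl
at-step-≢ {suc t} {e} {e′} (x ∷ v) e′≢e | no _ with e′ ≟ t
... | yes _ = refl
... | no _  = at-step-≢ v e′≢e

at-step-bounds : ∀ e e′ (v : Vec ℕ t) →
  at v e′ ≤ at (step e v) e′ × at (step e v) e′ ≤ suc (at v e′)
at-step-bounds e e′ [] = z≤n , z≤n
at-step-bounds {suc t} e e′ (x ∷ v) with e ≟ t
at-step-bounds {suc t} e e′ (x ∷ v) | yes _ with e′ ≟ t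
... | yes _ = n≤1+n x , ≤-refl
... | no _  = ≤-refl , n≤1+n _
at-step-bounds {suc t} e e′ (x ∷ v) | no _ with e′ ≟ t
... | yes _ = ≤-refl , n≤1+n x
... | no _  = at-step-bounds e e′ v

-- The sum of f over the paths of k unit steps from v in distinct directions
-- from U; for k = |U| these are the simplices of Kuhn's triangulation of the
-- cube at v.
pathSum : ℕ → List ℕ → Vec ℕ t → (List (Vec ℕ t) → Bool) → Bool
pathSum zero    U v f = f (v ∷ [])
pathSum (suc k) U v f = pick (λ u U′ → pathSum k U′ (step u v) (f ∘ (v ∷_))) U

pathSum-cong : ∀ k U (v : Vec ℕ t) {f g} → (∀ S → f S ≡ g S) → pathSum k U v f ≡ pathSum k U v g
pathSum-cong zero    U v eq = eq _
pathSum-cong (suc k) U v eq = pick-cong U λ u U′ _ → pathSum-cong k U′ (step u v) (eq ∘ (v ∷_))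

pathSum-xor : ∀ k U (v : Vec ℕ t) f g →
  pathSum k U v (λ S → f S xor g S) ≡ pathSum k U v f xor pathSum k U v g
pathSum-xor zero    U v f g = refl
pathSum-xor (suc k) U v f g =
  trans (pick-cong U λ u U′ _ → pathSum-xor k U′ (step u v) _ _) (pick-xor _ _ U)

-- The paths with an inner vertex removed cancel in pairs, by exchanging the
-- two steps at that vertex.
pathSum-δ : ∀ k U (v : Vec ℕ t) f →
  pathSum (suc k) U v (δ f) ≡
  pick (λ u U′ → pathSum k U′ (step u v) f) U xor pick (λ u U′ → pathSum k U′ v f) U
pathSum-δ zero U v f = trans
  (pick-cong U λ u U′ _ → cong (f (step u v ∷ []) xor_) (xor-identityʳ _)) (pick-xor _ _ U)
pathSum-δ (suc k) U v f = begin
  pathSum (suc (suc k)) U v (δ f)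
    ≡⟨ pick-cong U (λ u U′ _ → pathSum-xor (suc k) U′ (step u v) f (δ (f ∘ (v ∷_)))) ⟩
  pick (λ u U′ → pathSum (suc k) U′ (step u v) f xor
                 pathSum (suc k) U′ (step u v) (δ (f ∘ (v ∷_)))) U
    ≡⟨ pick-xor _ _ U ⟩
  pick (λ u U′ → pathSum (suc k) U′ (step u v) f) U xor
  pick (λ u U′ → pathSum (suc k) U′ (step u v) (δ (f ∘ (v ∷_)))) U
    ≡⟨ cong (pick (λ u U′ → pathSum (suc k) U′ (step u v) f) U xor_) rest ⟩
  pick (λ u U′ → pathSum (suc k) U′ (step u v) f) U xor pick (λ u U′ → pathSum (suc k) U′ v f) U ∎
  where
  open ≡-Reasoning
  F : ℕ → ℕ → List ℕ → Bool
  F u w U″ = pathSum k U″ (step w (step u v)) (f ∘ (v ∷_))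
  G : ℕ → ℕ → List ℕ → Bool
  G u w U″ = pathSum k U″ (step u v) (f ∘ (v ∷_))
  rest : pick (λ u U′ → pathSum (suc k) U′ (step u v) (δ (f ∘ (v ∷_)))) U ≡
         pick (λ u U′ → pathSum (suc k) U′ v f) U
  rest = begin
    pick (λ u U′ → pathSum (suc k) U′ (step u v) (δ (f ∘ (v ∷_)))) U
      ≡⟨ pick-cong U (λ u U′ _ → pathSum-δ k U′ (step u v) (f ∘ (v ∷_))) ⟩
    pick (λ u U′ → pick (F u) U′ xor pick (G u) U′) U
      ≡⟨ pick-xor _ _ U ⟩
    pick₂ F U xor pick₂ G U
      ≡⟨ cong (_xor pick₂ G U) (pick₂-symmetric F
           (λ u w U″ → cong (λ z → pathSum k U″ z (f ∘ (v ∷_))) (step-comm w u v)) U) ⟩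
    pick₂ G U
      ≡⟨ pick₂-swap G U ⟩
    pick (λ u U′ → pathSum (suc k) U′ v f) U ∎

Unique-resp-↭ : ∀ {U U′ : List ℕ} → U ↭ U′ → Unique U → Unique U′
Unique-resp-↭ p = Permutationₛ.Unique-resp-↭ (≡.setoid ℕ) (↭⇒↭ₛ p)

-- An odd sum has an odd term, which gives an actual simplex. As `U` has no repetitions, its path
-- steps at most once in each direction.
pathSum-support : ∀ k U (v : Vec ℕ t) {f} → Unique U → pathSum k U v f ≡ true →
  ∃ λ S → f S ≡ true ×
    All (λ w → ∀ e → (at v e ≤ at w e × at w e ≤ suc (at v e)) × (e ∉ U → at w e ≡ at v e)) S
pathSum-support zero    U v unique eq =
  v ∷ [] , eq , (λ e → (≤-refl , n≤1+n _) , λ _ → refl) ∷ []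
pathSum-support (suc k) U v unique eq with pick-witness U eq
... | u , U′ , p , eq′ with Unique-resp-↭ (↭-sym p) unique
...   | u≢ ∷ unique′ with pathSum-support k U′ (step u v) unique′ eq′
...     | S , fS , near = v ∷ S , fS ,
  (λ e → (≤-refl , n≤1+n _) , λ _ → refl) ∷ All.map (λ {w} → widen {w}) near
  where
  widen : ∀ {w} →
    (∀ e → (at (step u v) e ≤ at w e × at w e ≤ suc (at (step u v) e)) ×
      (e ∉ U′ → at w e ≡ at (step u v) e)) →
    ∀ e → (at v e ≤ at w e × at w e ≤ suc (at v e)) × (e ∉ U → at w e ≡ at v e)
  widen near e with e ≟ u | near e
  ... | yes refl | _ , fixed rewrite fixed (All¬⇒¬Any u≢) =
        at-step-bounds u u v , λ u∉U → contradiction (∈-resp-↭ p (here refl)) u∉U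
  ... | no e≢u | bounds , fixed rewrite at-step-≢ v e≢u =
        bounds , λ e∉U → fixed (e∉U ∘ ∈-resp-↭ p ∘ there)

-- No step goes in the direction `u`, so all vertices of a path stay in the hyperplane through `v`
-- on which `f` vanishes.
pathSum-face : ∀ k {u U} (v : Vec ℕ t) {f c} → Unique (u ∷ U) → at v u ≡ c →
  (∀ S → All (λ w → at w u ≡ c) S → f S ≡ false) → pathSum k U v f ≡ false
pathSum-face k {u} {U} v {f} (u≢ ∷ unique) at≡c zeroᶠ with pathSum k U v f in eq
... | false = refl
... | true with pathSum-support k U v unique eq
...   | S , fS , near = trans (sym fS)
        (zeroᶠ S (All.map (λ {w} near → trans (proj₂ (near u) (All¬⇒¬Any u≢)) at≡c) near))

pathSum-∷ : ∀ k {U} x (v : Vec ℕ t) f → All (_<ᴺ t) U →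
  pathSum k U (x ∷ v) f ≡ pathSum k U v (f ∘ map (x ∷_))
pathSum-∷ zero        x v f U<t = refl
pathSum-∷ (suc k) {U} x v f U<t = pick-cong U λ u U′ p → case u U′ (All-resp-↭ (↭-sym p) U<t)
  where
  case : ∀ u U′ → All (_<ᴺ _) (u ∷ U′) →
    pathSum k U′ (step u (x ∷ v)) (f ∘ ((x ∷ v) ∷_)) ≡
    pathSum k U′ (step u v) (f ∘ map (x ∷_) ∘ (v ∷_))
  case u U′ (u<t ∷ U′<t) rewrite step-∷ x v u<t = pathSum-∷ k x (step u v) (f ∘ ((x ∷ v) ∷_)) U′<t

-- Sums over the cube and Stokes' theorem.

rangeSum : ℕ → (ℕ → Bool) → Bool
rangeSum zero    F = false
rangeSum (suc N) F = F N xor rangeSum N F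

rangeSum-cong : ∀ N {F G} → (∀ x → F x ≡ G x) → rangeSum N F ≡ rangeSum N G
rangeSum-cong zero    eq = refl
rangeSum-cong (suc N) eq = cong₂ _xor_ (eq N) (rangeSum-cong N eq)

rangeSum-false : ∀ N → rangeSum N (λ _ → false) ≡ false
rangeSum-false zero    = refl
rangeSum-false (suc N) = rangeSum-false N

rangeSum-xor : ∀ N F G → rangeSum N (λ x → F x xor G x) ≡ rangeSum N F xor rangeSum N G
rangeSum-xor zero    F G = refl
rangeSum-xor (suc N) F G =
  trans (cong ((F N xor G N) xor_) (rangeSum-xor N F G)) (xor-interchange (F N) (G N) _ _)

rangeSum-telescope : ∀ N (F : ℕ → Bool) → rangeSum N (λ x → F (suc x) xor F x) ≡ F N xor F 0
rangeSum-telescope zero    F = sym (xor-same (F 0))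
rangeSum-telescope (suc N) F = begin
  (F (suc N) xor F N) xor rangeSum N (λ x → F (suc x) xor F x)
    ≡⟨ cong ((F (suc N) xor F N) xor_) (rangeSum-telescope N F) ⟩
  (F (suc N) xor F N) xor (F N xor F 0)
    ≡⟨ xor-assoc (F (suc N)) _ _ ⟩
  F (suc N) xor (F N xor (F N xor F 0))
    ≡⟨ cong (F (suc N) xor_) (xor-cancelˡ (F N) (F 0)) ⟩
  F (suc N) xor F 0 ∎
  where open ≡-Reasoning

rangeSum-witness : ∀ N {F} → rangeSum N F ≡ true → ∃ λ x → F x ≡ true
rangeSum-witness (suc N) {F} eq with F N in FN
... | true  = N , FN
... | false = rangeSum-witness N eq

module _ (N : ℕ) where

  -- Coordinates stop at `N` minus 1: the vectors are the lower corners of the unit cubes, whose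
  -- vertices reach `N`.
  cubeSum : ∀ t → (Vec ℕ t → Bool) → Bool
  cubeSum zero    F = F []
  cubeSum (suc t) F = rangeSum N λ x → cubeSum t (F ∘ (x ∷_))

  cubeSum-cong : ∀ t {F G} → (∀ v → F v ≡ G v) → cubeSum t F ≡ cubeSum t G
  cubeSum-cong zero    eq = eq []
  cubeSum-cong (suc t) eq = rangeSum-cong N λ x → cubeSum-cong t (eq ∘ (x ∷_))

  cubeSum-xor : ∀ t F G → cubeSum t (λ v → F v xor G v) ≡ cubeSum t F xor cubeSum t G
  cubeSum-xor zero    F G = refl
  cubeSum-xor (suc t) F G =
    trans (rangeSum-cong N λ x → cubeSum-xor t (F ∘ (x ∷_)) (G ∘ (x ∷_))) (rangeSum-xor N _ _)

  cubeSum-false : ∀ t → cubeSum t (λ _ → false) ≡ false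
  cubeSum-false zero    = refl
  cubeSum-false (suc t) = trans (rangeSum-cong N λ _ → cubeSum-false t) (rangeSum-false N)

  cubeSum-pick : ∀ t {A : Set} (F : Vec ℕ t → A → List A → Bool) U →
    cubeSum t (λ v → pick (F v) U) ≡ pick (λ u U′ → cubeSum t (λ v → F v u U′)) U
  cubeSum-pick t F []      = cubeSum-false t
  cubeSum-pick t F (u ∷ U) = trans (cubeSum-xor t _ _)
    (cong (cubeSum t (λ v → F v u U) xor_) (cubeSum-pick t (λ v w U′ → F v w (u ∷ U′)) U))

  cubeSum-witness : ∀ t {F} → cubeSum t F ≡ true → ∃ λ v → F v ≡ true
  cubeSum-witness zero    eq = [] , eq
  cubeSum-witness (suc t) eq with rangeSum-witness N eq
  ... | x , eq′ with cubeSum-witness t eq′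
  ...   | v , Fv = x ∷ v , Fv

  cubeSum-telescope : ∀ t (G : Vec ℕ (suc t) → Bool) →
    cubeSum (suc t) (λ v → G (step t v) xor G v) ≡
    cubeSum t (G ∘ (N ∷_)) xor cubeSum t (G ∘ (0 ∷_))
  cubeSum-telescope t G = trans
    (rangeSum-cong N λ x → trans
      (cubeSum-cong t λ v → cong (λ w → G w xor G (x ∷ v)) (step-top x v))
      (cubeSum-xor t (G ∘ (suc x ∷_)) (G ∘ (x ∷_))))
    (rangeSum-telescope N (λ x → cubeSum t (G ∘ (x ∷_))))

  -- Telescoping in the direction `u` leaves only the two opposite facets, and `G` vanishes on both.
  cubeSum-step : ∀ t {u} (G : Vec ℕ t → Bool) → u <ᴺ t →
    (∀ v → at v u ≡ 0 → G v ≡ false) → (∀ v → at v u ≡ N → G v ≡ false) →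
    cubeSum t (λ v → G (step u v) xor G v) ≡ false
  cubeSum-step (suc t) {u} G u<1+t G₀ Gₙ with m≤n⇒m<n∨m≡n (≤-pred u<1+t)
  ... | inj₂ refl = trans (cubeSum-telescope t G) (cong₂ _xor_
        (trans (cubeSum-cong t λ v → Gₙ (N ∷ v) (at-top N v)) (cubeSum-false t))
        (trans (cubeSum-cong t λ v → G₀ (0 ∷ v) (at-top 0 v)) (cubeSum-false t)))
  ... | inj₁ u<t = trans (rangeSum-cong N inner) (rangeSum-false N)
    where
    inner : ∀ x → cubeSum t (λ v → G (step u (x ∷ v)) xor G (x ∷ v)) ≡ false
    inner x = trans (cubeSum-cong t λ v → cong (λ w → G w xor G (x ∷ v)) (step-∷ x v u<t))
      (cubeSum-step t (G ∘ (x ∷_)) u<t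
        (λ v p → G₀ (x ∷ v) (trans (at-∷ x v u<t) p))
        (λ v p → Gₙ (x ∷ v) (trans (at-∷ x v u<t) p)))

  kuhnSum : ∀ t → (List (Vec ℕ t) → Bool) → Bool
  kuhnSum t f = cubeSum t λ v → pathSum t (downFrom t) v f

  -- Stokes' theorem for cochains that vanish on all facets of the cube but one.
  kuhnSum-δ : ∀ t (f : List (Vec ℕ (suc t)) → Bool) →
    (∀ {e} → e <ᴺ suc t → ∀ S → All (λ v → at v e ≡ 0) S → f S ≡ false) →
    (∀ {e} → e <ᴺ t → ∀ S → All (λ v → at v e ≡ N) S → f S ≡ false) →
    kuhnSum (suc t) (δ f) ≡ kuhnSum t (f ∘ map (N ∷_))
  kuhnSum-δ t f f₀ fₙ = begin
    kuhnSum (suc t) (δ f)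
      ≡⟨ cubeSum-cong (suc t) (λ v → trans (pathSum-δ t U v f)
           (sym (pick-xor (λ u U′ → pathSum t U′ (step u v) f) (λ u U′ → pathSum t U′ v f) U))) ⟩
    cubeSum (suc t) (λ v → pick (λ u U′ → pathSum t U′ (step u v) f xor pathSum t U′ v f) U)
      ≡⟨ cubeSum-pick (suc t) (λ v u U′ → pathSum t U′ (step u v) f xor pathSum t U′ v f) U ⟩
    -- For each omitted direction the sum telescopes to two opposite facets; only the facet at `N`
    -- in the direction `t` can contribute.
    G t (downFrom t) xor pick (λ u U′ → G u (t ∷ U′)) (downFrom t)
      ≡⟨ cong₂ _xor_ front (pick-false (downFrom t) side) ⟩
    kuhnSum t (f ∘ map (N ∷_)) xor false
      ≡⟨ xor-identityʳ _ ⟩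
    kuhnSum t (f ∘ map (N ∷_)) ∎
    where
    open ≡-Reasoning
    U = downFrom (suc t)
    G : ℕ → List ℕ → Bool
    G u U′ = cubeSum (suc t) λ v → pathSum t U′ (step u v) f xor pathSum t U′ v f
    front : G t (downFrom t) ≡ kuhnSum t (f ∘ map (N ∷_))
    front = begin
      G t (downFrom t)
        ≡⟨ cubeSum-telescope t (λ v → pathSum t (downFrom t) v f) ⟩
      cubeSum t (λ v → pathSum t (downFrom t) (N ∷ v) f) xor
      cubeSum t (λ v → pathSum t (downFrom t) (0 ∷ v) f)
        ≡⟨ cong₂ _xor_
             (cubeSum-cong t λ v → pathSum-∷ t N v f (All.tabulate ∈-downFrom⁻))
             (trans
               (cubeSum-cong t λ v →
                 pathSum-face t (0 ∷ v) (downFrom⁺ (suc t)) (at-top 0 v) (f₀ ≤-refl))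
               (cubeSum-false t)) ⟩
      kuhnSum t (f ∘ map (N ∷_)) xor false
        ≡⟨ xor-identityʳ _ ⟩
      kuhnSum t (f ∘ map (N ∷_)) ∎
    side : ∀ u U′ → u ∷ U′ ↭ downFrom t → G u (t ∷ U′) ≡ false
    side u U′ p = cubeSum-step (suc t) (λ v → pathSum t (t ∷ U′) v f) u<1+t
      (λ v eq → pathSum-face t v unique eq (f₀ u<1+t))
      (λ v eq → pathSum-face t v unique eq (fₙ u<t))
      where
      u<t : u <ᴺ t
      u<t = ∈-downFrom⁻ (∈-resp-↭ p (here refl))
      u<1+t : u <ᴺ suc t
      u<1+t = ≤-trans u<t (n≤1+n t)
      unique : Unique (u ∷ t ∷ U′)
      unique = Unique-resp-↭ (↭-trans (↭-prep t (↭-sym p)) (swap t u refl)) (downFrom⁺ (suc t))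

-- Spanning trees of complete bipartite graphs as determinants.

is : ∀ {A : Set} → (A → ℕ) → ℕ → A → Bool
is f i x = does (f x ≟ i)

total-↭ : ∀ {A : Set} {Φ Ψ : List (A → Bool)} → Φ ↭ Ψ → ∀ k → total Φ k ≡ total Ψ k
total-↭ refl           k = refl
total-↭ (prep φ p)     k = cong (φ k xor_) (total-↭ p k)
total-↭ (swap {xs = Φ} {Ψ} φ ψ p) k = begin
  φ k xor (ψ k xor total Φ k) ≡⟨ cong (λ z → φ k xor (ψ k xor z)) (total-↭ p k) ⟩
  φ k xor (ψ k xor total Ψ k) ≡⟨ xor-assoc (φ k) _ _ ⟨
  (φ k xor ψ k) xor total Ψ k ≡⟨ cong (_xor total Ψ k) (xor-comm (φ k) _) ⟩
  (ψ k xor φ k) xor total Ψ k ≡⟨ xor-assoc (ψ k) _ _ ⟩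
  ψ k xor (φ k xor total Ψ k) ∎ where open ≡-Reasoning
total-↭ (transᵖ p q)   k = trans (total-↭ p k) (total-↭ q k)

total-++ : ∀ {A : Set} (Φ Ψ : List (A → Bool)) k → total (Φ ++ Ψ) k ≡ total Φ k xor total Ψ k
total-++ []      Ψ k = refl
total-++ (φ ∷ Φ) Ψ k = trans (cong (φ k xor_) (total-++ Φ Ψ k)) (sym (xor-assoc (φ k) _ _))

total-is : ∀ {A : Set} (f : A → ℕ) n k → total (map (is f) (downFrom n)) k ≡ does (f k <? n)
total-is f zero    k = refl
total-is f (suc n) k rewrite total-is f n k with f k ≟ n | f k <? n
... | yes fk≡n | _ rewrite dec-true (f k ≟ n) fk≡n | dec-false (f k <? n) (<-irrefl fk≡n)
                         | dec-true (f k <? suc n) (s≤s (≤-reflexive fk≡n)) = refl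
... | no fk≢n | yes fk<n rewrite dec-false (f k ≟ n) fk≢n | dec-true (f k <? n) fk<n
                               | dec-true (f k <? suc n) (m<n⇒m<1+n fk<n) = refl
... | no fk≢n | no fk≮n rewrite dec-false (f k ≟ n) fk≢n | dec-false (f k <? n) fk≮n
                              | dec-false (f k <? suc n)
                                  (λ fk<1+n → fk≮n (≤∧≢⇒< (≤-pred fk<1+n) fk≢n)) = refl

without : ℕ → List ℕ → List ℕ
without ρ = filter (λ i → ¬? (i ≟ ρ))

without-↭ : ∀ {ρ k} → ρ <ᴺ k → ρ ∷ without ρ (downFrom k) ↭ downFrom k
without-↭ {ρ} {suc k} ρ<1+k with m≤n⇒m<n∨m≡n (≤-pred ρ<1+k)
... | inj₁ ρ<k = ↭-trans
  (↭-prep ρ (↭-reflexive (filter-accept (λ i → ¬? (i ≟ ρ)) (<⇒≢ ρ<k ∘ sym))))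
  (↭-trans (swap ρ k refl) (↭-prep k (without-↭ ρ<k)))
... | inj₂ refl = ↭-prep ρ (↭-reflexive (trans
  (filter-reject (λ i → ¬? (i ≟ ρ)) (λ ρ≢ρ → ρ≢ρ refl))
  (filter-all (λ i → ¬? (i ≟ ρ)) (All.tabulate (<⇒≢ ∘ ∈-downFrom⁻)))))

-- The common rest `K` serves to compare two choices of the omitted column.
without-↭₂ : ∀ {ρ ρ′ k} → ρ ≢ ρ′ → ρ <ᴺ k → ρ′ <ᴺ k →
  ∃ λ K → ρ′ ∷ K ↭ without ρ (downFrom k) × ρ ∷ K ↭ without ρ′ (downFrom k)
without-↭₂ {ρ} {ρ′} {k} ρ≢ρ′ ρ<k ρ′<k with ∈-resp-↭ (↭-sym (without-↭ ρ<k)) (∈-downFrom⁺ ρ′<k)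
... | here ρ′≡ρ = contradiction (sym ρ′≡ρ) ρ≢ρ′
... | there ρ′∈ with ∈⇒↭ ρ′∈
  where
  ∈⇒↭ : ∀ {x : ℕ} {xs} → x ∈ xs → ∃ λ ys → x ∷ ys ↭ xs
  ∈⇒↭ (here refl) = _ , refl
  ∈⇒↭ {x} {y ∷ xs} (there x∈xs) with ∈⇒↭ x∈xs
  ... | ys , p = y ∷ ys , ↭-trans (swap x y refl) (↭-prep y p)
... | K , p = K , p , drop-∷ (↭-trans (swap ρ′ ρ refl)
  (↭-trans (↭-prep ρ p) (↭-trans (without-↭ ρ<k) (↭-sym (without-↭ ρ′<k)))))

-- A label (i , j) says that some set lies in the i-th horizontal strip and the
-- j-th vertical strip.
Label : Set
Label = ℕ × ℕ

row col : Label → ℕ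
row = proj₁
col = proj₂

rows : ℕ → List (Label → Bool)
rows p = map (is row) (downFrom p)

cols : ℕ → ℕ → List (Label → Bool)
cols ρ k = map (is col) (without ρ (downFrom k))

-- Seen as an edge of the bipartite graph on p rows and k columns, a label takes the
-- value 1 on its two endpoints; as these p + k functionals add up to 0, the wedge of
-- all of them but the column ρ tests for a spanning tree, whatever ρ is.
Φ : ℕ → ℕ → ℕ → List (Label → Bool)
Φ p k ρ = rows p ++ cols ρ k

InGrid : ℕ → ℕ → Label → Set
InGrid p k ℓ = row ℓ <ᴺ p × col ℓ <ᴺ k

-- The rows and the columns both add up to 1.
balance : ∀ {p k ρ ℓ} → ρ <ᴺ k → InGrid p k ℓ → is col ρ ℓ ≡ total (Φ p k ρ) ℓ
balance {p} {k} {ρ} {ℓ} ρ<k (r<p , c<k) = sym (begin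
  total (Φ p k ρ) ℓ                       ≡⟨ total-++ (rows p) _ ℓ ⟩
  total (rows p) ℓ xor total (cols ρ k) ℓ
    ≡⟨ cong (_xor total (cols ρ k) ℓ) (trans (total-is row p ℓ) (dec-true (row ℓ <? p) r<p)) ⟩
  true xor total (cols ρ k) ℓ             ≡⟨ cong (_xor total (cols ρ k) ℓ) one ⟨
  (is col ρ ℓ xor total (cols ρ k) ℓ) xor total (cols ρ k) ℓ
    ≡⟨ xor-assoc (is col ρ ℓ) _ _ ⟩
  is col ρ ℓ xor (total (cols ρ k) ℓ xor total (cols ρ k) ℓ)
    ≡⟨ cong (is col ρ ℓ xor_) (xor-same (total (cols ρ k) ℓ)) ⟩
  is col ρ ℓ xor false                    ≡⟨ xor-identityʳ _ ⟩
  is col ρ ℓ                              ∎)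
  where
  open ≡-Reasoning
  one : is col ρ ℓ xor total (cols ρ k) ℓ ≡ true
  one = trans (total-↭ (map⁺ (is col) (without-↭ ρ<k)) ℓ)
              (trans (total-is col k ℓ) (dec-true (col ℓ <? k) c<k))

-- The two lists share `Ψ`, and by `balance` the columns `ρ` and `ρ′` differ by the sum of `Ψ` on
-- the grid, so a row operation exchanges them.
wedge-reroot : ∀ {p k ρ ρ′ S} → ρ <ᴺ k → ρ′ <ᴺ k → All (InGrid p k) S →
  wedge (Φ p k ρ) S ≡ wedge (Φ p k ρ′) S
wedge-reroot {p} {k} {ρ} {ρ′} {S} ρ<k ρ′<k grid with ρ ≟ ρ′
... | yes refl = refl
... | no ρ≢ρ′ with without-↭₂ ρ≢ρ′ ρ<k ρ′<k
...   | K , p₁ , p₂ = begin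
  wedge (Φ p k ρ) S          ≡⟨ wedge-↭ (pull p₁) S ⟩
  wedge (is col ρ′ ∷ Ψ) S    ≡⟨ wedge-span {Φ = Ψ} S
                                  (All.map (λ {ℓ} g → trans (balance ρ<k g) (total-↭ (pull p₁) ℓ)) grid) ⟨
  wedge (is col ρ ∷ Ψ) S     ≡⟨ wedge-↭ (pull p₂) S ⟨
  wedge (Φ p k ρ′) S         ∎
  where
  open ≡-Reasoning
  Ψ = rows p ++ map (is col) K
  pull : ∀ {i L} → i ∷ K ↭ L → rows p ++ map (is col) L ↭ is col i ∷ Ψ
  pull {i} q = ↭-trans (++⁺ˡ (rows p) (map⁺ (is col) (↭-sym q))) (shift (is col i) (rows p) _)

cols-∈ : ∀ {r ρ k} p → r ≢ ρ → r <ᴺ k → is col r ∈ Φ p k ρ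
cols-∈ {ρ = ρ} p r≢ρ r<k =
  ∈-++⁺ʳ (rows p) (∈-map⁺ (is col) (∈-filter⁺ (λ i → ¬? (i ≟ ρ)) (∈-downFrom⁺ r<k) r≢ρ))

wedge-colAbsent : ∀ {r Ψ S} → All (λ ℓ → col ℓ ≢ r) S → wedge (is col r ∷ Ψ) S ≡ false
wedge-colAbsent {r} {Ψ} {S} absent =
  wedge-vanish {Φ = is col r ∷ Ψ} (here refl) S (All.map (λ {ℓ} → dec-false (col ℓ ≟ r)) absent)

-- Permuted lists have equal sums, and the sum of `L` cancels.
∷-injectiveˡ-↭ : ∀ {x y} {L : List ℕ} → x ∷ L ↭ y ∷ L → x ≡ y
∷-injectiveˡ-↭ {L = L} p = +-cancelʳ-≡ (sumᴸ L) _ _ (sum-↭ p)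

-- Cochains of spanning trees with prescribed column degrees.

module _ (em : ExcludedMiddle 0ℓ) where

  -- A list up to permutation is a multiset; `L` contains each column as often as its prescribed
  -- degree.
  coloured? : List ℕ → List Label → Bool
  coloured? L S = does (em {map col S ↭ L})

  cochain : List ℕ → List (Label → Bool) → List Label → Bool
  cochain L Ψ S = coloured? L S ∧ wedge Ψ S

  cochain-colourAbsent : ∀ {j L} Ψ {S} → j ∈ L → All (λ ℓ → col ℓ ≢ j) S → cochain L Ψ S ≡ false
  cochain-colourAbsent Ψ {S} j∈L absent = cong (_∧ wedge Ψ S) (dec-false em λ p →
    let ℓ , ℓ∈S , j≡ = ∈-map⁻ col (∈-resp-↭ (↭-sym p) j∈L) in All.lookup absent ℓ∈S (sym j≡))

  cochain-vanish : ∀ {L Ψ S φ} → φ ∈ Ψ → All (λ ℓ → φ ℓ ≡ false) S → cochain L Ψ S ≡ false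
  cochain-vanish {L} {S = S} φ∈Ψ zeroᶠ =
    trans (cong (coloured? L S ∧_) (wedge-vanish φ∈Ψ S zeroᶠ)) (∧-zeroʳ _)

  -- Taking an element k out of S leaves the colours L iff k has the colour r by which
  -- the colours of S exceed L.
  δ-cochain : ∀ {L ρ Ψ ψ} S →
    wedge (is col ρ ∷ Ψ) S ≡ wedge (ψ ∷ Ψ) S →
    (∀ r → r ≢ ρ → map col S ↭ r ∷ L → wedge (is col r ∷ Ψ) S ≡ false) →
    δ (cochain L Ψ) S ≡ cochain (ρ ∷ L) (ψ ∷ Ψ) S
  δ-cochain {L} {ρ} {Ψ} {ψ} S span other with em {∃ λ r → map col S ↭ r ∷ L}
  ... | no ¬p = trans
    (pick-false S λ k S′ q → cong (_∧ wedge Ψ S′) (dec-false em λ p →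
      ¬p (col k , ↭-trans (map⁺ col (↭-sym q)) (↭-prep (col k) p))))
    (sym (cong (_∧ wedge (ψ ∷ Ψ) S) (dec-false em (¬p ∘ (ρ ,_)))))
  ... | yes (r , p) = trans removed (compare (r ≟ ρ))
    where
    coloured-rest : ∀ k S′ → k ∷ S′ ↭ S → coloured? L S′ ≡ is col r k
    coloured-rest k S′ q with col k ≟ r
    ... | yes refl = trans (dec-true em (drop-∷ (↭-trans (map⁺ col q) p)))
          (sym (dec-true (col k ≟ r) refl))
    ... | no c≢r = trans
          (dec-false em λ p′ → c≢r (∷-injectiveˡ-↭
            (↭-trans (↭-prep (col k) (↭-sym p′)) (↭-trans (map⁺ col q) p))))
          (sym (dec-false (col k ≟ r) c≢r))
    -- The sum over the removed element is the expansion of this determinant along its first row.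
    removed : δ (cochain L Ψ) S ≡ wedge (is col r ∷ Ψ) S
    removed = pick-cong S λ k S′ q → cong (_∧ wedge Ψ S′) (coloured-rest k S′ q)
    compare : Dec (r ≡ ρ) → wedge (is col r ∷ Ψ) S ≡ cochain (ρ ∷ L) (ψ ∷ Ψ) S
    compare (yes refl) = trans span (sym (cong (_∧ wedge (ψ ∷ Ψ) S) (dec-true em p)))
    compare (no r≢ρ) = trans (other r r≢ρ p) (sym (cong (_∧ wedge (ψ ∷ Ψ) S)
      (dec-false em λ p′ → r≢ρ (∷-injectiveˡ-↭ (↭-trans (↭-sym p) p′)))))

  -- Let `r` be the colour that the coboundary adds. If it is not the new column `1 + t`, the
  -- functional of `r` depends on those already in `Φ` or vanishes on `S`.
  δ-newColumn : ∀ t {S} → All (InGrid 1 (2 + t)) S →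
    δ (cochain (downFrom (1 + t)) (Φ 1 (1 + t) 0)) S ≡ cochain (downFrom (2 + t)) (Φ 1 (2 + t) 0) S
  δ-newColumn t {S} grid = trans
    (δ-cochain {ρ = 1 + t} {Φ 1 (1 + t) 0} {is col (1 + t)} S refl other)
    (cong (coloured? (downFrom (2 + t)) S ∧_)
      (wedge-swap (is col (1 + t)) (is row 0) (cols 0 (1 + t)) S))
    where
    other : ∀ r → r ≢ 1 + t → map col S ↭ r ∷ downFrom (1 + t) →
      wedge (is col r ∷ Φ 1 (1 + t) 0) S ≡ false
    -- Column 0 is missing from `Φ`, but here no label lies in the new column, so `balance` holds on
    -- the narrower grid.
    other zero r≢ p = trans
      (wedge-span {ψ = λ _ → false} {Φ 1 (1 + t) 0} S (All.tabulate λ {ℓ} ℓ∈S →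
        balance {1} z<s (proj₁ (All.lookup grid ℓ∈S) , narrow (∈-resp-↭ p (∈-map⁺ col ℓ∈S)))))
      (pick-false S λ _ _ _ → refl)
      where
      narrow : ∀ {c} → c ∈ 0 ∷ downFrom (1 + t) → c <ᴺ 1 + t
      narrow (here refl) = z<s
      narrow (there c∈)  = ∈-downFrom⁻ c∈
    other (suc r) r≢ p with suc r <? 1 + t
    ... | yes r<1+t = wedge-∈ (cols-∈ 1 (λ ()) r<1+t) S
    ... | no r≮1+t = wedge-colAbsent {Ψ = Φ 1 (1 + t) 0} (All.map (λ { {ℓ} (_ , c<2+t) refl →
            r≮1+t (≤∧≢⇒< (≤-pred c<2+t) r≢) }) grid)

  -- By `balance` the column `ρ` is the new row plus the sum of the old functionals, so the new row
  -- may replace it. Any other added colour repeats a functional or does not occur.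
  δ-newRow : ∀ q n {ρ ρ′ L S} → ρ <ᴺ 1 + n → ρ′ <ᴺ 1 + n → All (InGrid (2 + q) (1 + n)) S →
    δ (cochain L (Φ (1 + q) (1 + n) ρ)) S ≡ cochain (ρ ∷ L) (Φ (2 + q) (1 + n) ρ′) S
  δ-newRow q n {ρ} {ρ′} {L} {S} ρ<1+n ρ′<1+n grid = trans
    (δ-cochain {L} {ρ} {Φ (1 + q) (1 + n) ρ} {is row (1 + q)} S
      (wedge-span {Φ = Φ (1 + q) (1 + n) ρ} S (All.map (balance ρ<1+n) grid)) other)
    (cong (coloured? (ρ ∷ L) S ∧_) (wedge-reroot {2 + q} ρ<1+n ρ′<1+n grid))
    where
    other : ∀ r → r ≢ ρ → map col S ↭ r ∷ L →
      wedge (is col r ∷ Φ (1 + q) (1 + n) ρ) S ≡ false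
    other r r≢ρ _ with r <? 1 + n
    ... | yes r<1+n = wedge-∈ (cols-∈ (1 + q) r≢ρ r<1+n) S
    ... | no r≮1+n = wedge-colAbsent {Ψ = Φ (1 + q) (1 + n) ρ}
          (All.map (λ { (_ , c<1+n) refl → r≮1+n c<1+n }) grid)

-- Sperner labellings and the parity of good simplices.

++-cancelˡ-↭ : ∀ {A : Set} (xs : List A) {ys zs} → xs ++ ys ↭ xs ++ zs → ys ↭ zs
++-cancelˡ-↭ []       p = p
++-cancelˡ-↭ (x ∷ xs) p = ++-cancelˡ-↭ xs (drop-∷ p)

split : ∀ {A B : Set} {R : A → B → Set} (as : List A) {as′ bs} → Pointwise R (as ++ as′) bs →
  ∃₂ λ cs ds → bs ≡ cs ++ ds × Pointwise R as cs × Pointwise R as′ ds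
split []       rs       = [] , _ , refl , [] , rs
split (a ∷ as) (r ∷ rs) with split as rs
... | cs , ds , refl , rs₁ , rs₂ = _ ∷ cs , ds , refl , r ∷ rs₁ , rs₂

matched : ∀ {A : Set} {f : A → ℕ} {J T} →
  Pointwise (λ φ x → φ x ≡ true) (map (is f) J) T → map f T ≡ J
matched {J = []}    []       = refl
matched {f = f} {i ∷ J} {x ∷ T} (m ∷ ms) with f x ≟ i
... | yes p = cong₂ _∷_ p (matched ms)
... | no ¬p with () ← trans (sym m) (dec-false (f x ≟ i) ¬p)

Near : Vec ℕ t → Vec ℕ t → Set
Near v w = ∀ e → at v e ≤ at w e × at w e ≤ suc (at v e)

module _ (N : ℕ) where

  -- Sperner's boundary condition, for a line `i` at position `x` and a set in strip `k`: nothing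
  -- lies beneath a line at 0, and no set that reaches the grid lies beyond a line at `N`.
  Sides : ℕ → ℕ → ℕ → Set
  Sides x i k = (x ≡ 0 → k ≢ i) × (x ≡ N → k ≤ i)

  ColumnLabelling : ∀ t → (Vec ℕ t → Label) → Set
  ColumnLabelling t lab = ∀ v → InGrid 1 (1 + t) (lab v) ×
    (∀ {j} → j <ᴺ t → Sides (at v j) j (col (lab v)))

  GridLabelling : ∀ n q → (Vec ℕ (q + n) → Label) → Set
  GridLabelling n q lab = ∀ v → InGrid (1 + q) (1 + n) (lab v) ×
    (∀ {j} → j <ᴺ n → Sides (at v j) j (col (lab v))) ×
    (∀ {i} → i <ᴺ q → Sides (at v (i + n)) i (row (lab v)))

  kuhnSum-cong : ∀ t {f g} → (∀ S → f S ≡ g S) → kuhnSum N t f ≡ kuhnSum N t g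
  kuhnSum-cong t eq = cubeSum-cong N t λ v → pathSum-cong t (downFrom t) v eq

  -- Stokes' theorem for cochains on labels, pulled back along `lab`.
  kuhnSum-step : ∀ t (f g : List Label → Bool) {lab : Vec ℕ (suc t) → Label} →
    (∀ S → δ g (map lab S) ≡ f (map lab S)) →
    (∀ {e} → e <ᴺ suc t → ∀ S → All (λ v → at v e ≡ 0) S → g (map lab S) ≡ false) →
    (∀ {e} → e <ᴺ t → ∀ S → All (λ v → at v e ≡ N) S → g (map lab S) ≡ false) →
    kuhnSum N t (g ∘ map (lab ∘ (N ∷_))) ≡ true →
    kuhnSum N (suc t) (f ∘ map lab) ≡ true
  kuhnSum-step t f g {lab} δg g₀ gₙ ih = begin
    kuhnSum N (suc t) (f ∘ map lab)
      ≡⟨ kuhnSum-cong (suc t) (λ S → trans (sym (δg S)) (pick-map lab (λ _ → g) S)) ⟩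
    kuhnSum N (suc t) (δ (g ∘ map lab))
      ≡⟨ kuhnSum-δ N t (g ∘ map lab) g₀ gₙ ⟩
    kuhnSum N t (g ∘ map lab ∘ map (N ∷_))
      ≡⟨ kuhnSum-cong t (λ S → cong g (sym (map-∘ S))) ⟩
    kuhnSum N t (g ∘ map (lab ∘ (N ∷_)))
      ≡⟨ ih ⟩
    true ∎
    where open ≡-Reasoning

everywhere : ∀ {P : Label → Set} {lab : Vec ℕ t → Label} →
  (∀ v → P (lab v)) → ∀ S → All P (map lab S)
everywhere p S = All-map⁺ (All.universal p S)

restrict : ∀ {P : Vec ℕ t → Set} {Q : Label → Set} {lab : Vec ℕ t → Label} →
  (∀ v → P v → Q (lab v)) → ∀ S → All P S → All Q (map lab S)
restrict imp S = All-map⁺ ∘ All.map (λ {v} → imp v)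

height : ∀ {q n e} → e <ᴺ q + n → e <ᴺ n ⊎ ∃ λ i → i <ᴺ q × e ≡ i + n
height {q} {n} {e} e<q+n with e <? n
... | yes e<n = inj₁ e<n
... | no e≮n = inj₂ (e ∸ n , +-cancelʳ-< n _ _ (subst (_<ᴺ q + n) e≡ e<q+n) , e≡)
  where
  e≡ : e ≡ e ∸ n + n
  e≡ = sym (m∸n+n≡m (≮⇒≥ e≮n))

rows-∈ : ∀ {i p} k ρ → i <ᴺ p → is row i ∈ Φ p k ρ
rows-∈ k ρ i<p = ∈-++⁺ˡ (∈-map⁺ (is row) (∈-downFrom⁺ i<p))

module _ (em : ExcludedMiddle 0ℓ) (N : ℕ) where

  -- With a single row this is Sperner's lemma: the simplices counted are those on which every
  -- column occurs exactly once.
  columns-odd : ∀ t lab → ColumnLabelling N t lab →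
    kuhnSum N t (cochain em (downFrom (1 + t)) (Φ 1 (1 + t) 0) ∘ map lab) ≡ true
  columns-odd zero lab ok with lab [] | ok []
  ... | zero , zero | _ = cong (_∧ true) (dec-true em refl)
  ... | zero , suc _ | (_ , s≤s ()) , _
  ... | suc _ , _ | (s≤s () , _) , _
  columns-odd (suc t) lab ok = kuhnSum-step N t
    (cochain em (downFrom (2 + t)) (Φ 1 (2 + t) 0)) (cochain em (downFrom (1 + t)) (Φ 1 (1 + t) 0))
    (λ S → δ-newColumn em t (everywhere (proj₁ ∘ ok) S))
    (λ {e} e<1+t S bottom → cochain-colourAbsent em (Φ 1 (1 + t) 0) (∈-downFrom⁺ e<1+t)
      (restrict (λ v → proj₁ (proj₂ (ok v) e<1+t)) S bottom))
    -- A vertical line `e` at `N` keeps all labels in columns up to `e`, so column `t` is missing.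
    (λ {e} e<t S top → cochain-colourAbsent em (Φ 1 (1 + t) 0) (∈-downFrom⁺ (n<1+n t))
      (restrict (λ v v≡N c≡t →
        <⇒≱ e<t (subst (_≤ e) c≡t (proj₂ (proj₂ (ok v) (m<n⇒m<1+n e<t)) v≡N))) S top))
    (columns-odd t (lab ∘ (N ∷_)) λ v → let ((r<1 , _) , sides) = ok (N ∷ v) in
      (r<1 , s≤s (proj₂ (sides (n<1+n t)) (at-top N v))) ,
      λ {j} j<t → subst (λ x → Sides N x j _) (at-∷ N v j<t) (sides (m<n⇒m<1+n j<t)))

  -- The first n coordinates are the vertical lines. Every further coordinate adds a
  -- row, and an edge at the column ρ to the prescribed degrees; it does so when ρ is
  -- the column left out of Φ.
  grid-odd : ∀ n L {ρ} → All (_<ᴺ 1 + n) L → ρ <ᴺ 1 + n →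
    ∀ lab → GridLabelling N n (length L) lab →
    kuhnSum N (length L + n)
      (cochain em (L ++ downFrom (1 + n)) (Φ (1 + length L) (1 + n) ρ) ∘ map lab) ≡ true
  grid-odd n [] [] ρ<1+n lab ok = trans
    (kuhnSum-cong N n λ S → cong (coloured? em (downFrom (1 + n)) (map lab S) ∧_)
      (wedge-reroot {1} ρ<1+n z<s (everywhere (proj₁ ∘ ok) S)))
    (columns-odd n lab λ v → proj₁ (ok v) , proj₁ (proj₂ (ok v)))
  grid-odd n (ρ ∷ L) {ρ′} (ρ<1+n ∷ L<1+n) ρ′<1+n lab ok = kuhnSum-step N (q + n)
    (cochain em (ρ ∷ C) (Φ (2 + q) (1 + n) ρ′)) (cochain em C Ψ)
    (λ S → δ-newRow em q n ρ<1+n ρ′<1+n (everywhere (proj₁ ∘ ok) S))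
    bottom top
    (grid-odd n L L<1+n ρ<1+n (lab ∘ (N ∷_)) λ v →
      let ((_ , c<1+n) , colSides , rowSides) = ok (N ∷ v) in
      (s≤s (proj₂ (rowSides (n<1+n q)) (at-top N v)) , c<1+n) ,
      (λ {j} j<n →
        subst (λ x → Sides N x j _) (at-∷ N v (≤-trans j<n (m≤n+m n q))) (colSides j<n)) ,
      (λ {i} i<q →
        subst (λ x → Sides N x i _) (at-∷ N v (+-monoˡ-< n i<q)) (rowSides (m<n⇒m<1+n i<q))))
    where
    q = length L
    C = L ++ downFrom (1 + n)
    Ψ = Φ (1 + q) (1 + n) ρ
    bottom : ∀ {e} → e <ᴺ suc (q + n) → ∀ S → All (λ v → at v e ≡ 0) S →
      cochain em C Ψ (map lab S) ≡ false
    bottom {e} e< S at≡0 with height {suc q} e<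
    ... | inj₁ e<n = cochain-colourAbsent em Ψ (∈-++⁺ʳ L (∈-downFrom⁺ (m<n⇒m<1+n e<n)))
          (restrict (λ v → proj₁ (proj₁ (proj₂ (ok v)) e<n)) S at≡0)
    ... | inj₂ (i , i<1+q , refl) = cochain-vanish em {L = C} {Ψ = Ψ} (rows-∈ (1 + n) ρ i<1+q)
          (restrict (λ v v≡0 →
            dec-false (row (lab v) ≟ i) (proj₁ (proj₂ (proj₂ (ok v)) i<1+q) v≡0)) S at≡0)
    -- A line at `N` excludes all later strips: column `n` is missing if it is vertical, row `q` if
    -- it is horizontal.
    top : ∀ {e} → e <ᴺ q + n → ∀ S → All (λ v → at v e ≡ N) S →
      cochain em C Ψ (map lab S) ≡ false
    top {e} e< S at≡N with height {q} e<
    ... | inj₁ e<n = cochain-colourAbsent em Ψ (∈-++⁺ʳ L (∈-downFrom⁺ (n<1+n n)))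
          (restrict (λ v v≡N c≡n →
            <⇒≱ e<n (subst (_≤ e) c≡n (proj₂ (proj₁ (proj₂ (ok v)) e<n) v≡N))) S at≡N)
    ... | inj₂ (i , i<q , refl) = cochain-vanish em {L = C} {Ψ = Ψ} (rows-∈ (1 + n) ρ (n<1+n q))
          (restrict (λ v v≡N → dec-false (row (lab v) ≟ q) λ r≡q →
            <⇒≱ i<q (subst (_≤ i) r≡q (proj₂ (proj₂ (proj₂ (ok v)) (m<n⇒m<1+n i<q)) v≡N))) S at≡N)

  -- A matching of Φ with the labels of a good simplex splits them into one label per
  -- row and one label per column other than ρ; as all their columns are prescribed,
  -- so are those of the first part.
  sperner : ∀ n ρ L → All (_<ᴺ 1 + n) (ρ ∷ L) → ∀ lab → GridLabelling N n (length L) lab →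
    ∃₂ λ v W → All (Near v) W ×
      map (row ∘ lab) W ≡ downFrom (length (ρ ∷ L)) × map (col ∘ lab) W ↭ ρ ∷ L
  sperner n ρ L (ρ<1+n ∷ L<1+n) lab ok
    with cubeSum-witness N (length L + n) (grid-odd n L L<1+n ρ<1+n lab ok)
  ... | v , odd with pathSum-support (length L + n) _ v (downFrom⁺ (length L + n)) odd
  ... | S , eq , near with em {map col (map lab S) ↭ L ++ downFrom (1 + n)}
  ... | yes colours with wedge-witness (Φ (1 + length L) (1 + n) ρ) (map lab S) eq
  ... | _ , p , matches with split (rows (1 + length L)) matches
  ... | T , R , refl , rowsT , colsR with preimages T (∈-map⁻ lab ∘ ∈-resp-↭ p ∘ ∈-++⁺ˡ)
    where
    preimages : ∀ T → (∀ {ℓ} → ℓ ∈ T → ∃ λ w → w ∈ S × ℓ ≡ lab w) →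
      ∃ λ W → All (_∈ S) W × map lab W ≡ T
    preimages []      from = [] , [] , refl
    preimages (ℓ ∷ T) from with from (here refl) | preimages T (from ∘ there)
    ... | w , w∈S , refl | W , W⊆S , refl = w ∷ W , w∈S ∷ W⊆S , refl
  ... | W , W⊆S , refl = v , W ,
    All.map (λ w∈S e → proj₁ (All.lookup near w∈S e)) W⊆S ,
    trans (map-∘ {g = row} W) (matched {f = row} rowsT) ,
    ↭-trans (↭-reflexive (map-∘ {g = col} W))
      (++-cancelˡ-↭ D (↭-trans (++-comm D (map col T)) (↭-trans counted (++-comm (ρ ∷ L) D))))
    where
    open PermutationReasoning
    D = downFrom (1 + n)
    counted : map col T ++ D ↭ ρ ∷ L ++ D
    counted = begin
      map col T ++ D                               ↭⟨ ++⁺ˡ (map col T) (without-↭ ρ<1+n) ⟨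
      map col T ++ ρ ∷ without ρ D                 ↭⟨ shift ρ (map col T) _ ⟩
      ρ ∷ map col T ++ without ρ D                 ≡⟨ cong (λ J → ρ ∷ map col T ++ J) (matched {f = col} colsR) ⟨
      ρ ∷ map col T ++ map col R                   ≡⟨ cong (ρ ∷_) (map-++ col T R) ⟨
      ρ ∷ map col (T ++ R)                         ↭⟨ ↭-prep ρ (↭-trans (map⁺ col p) colours) ⟩
      ρ ∷ L ++ D                                   ∎

-- Intervals of grid points and the strips between lines.

Convex : Pred ℕ ℓ → Set ℓ
Convex H = ∀ {x y z} → x ≤ y → y ≤ z → H x → H z → H y

Below Above : Pred ℕ ℓ → ℕ → Set ℓ
Below H x = ∀ y → H y → x <ᴺ y
Above H x = ∀ y → H y → y <ᴺ x

-- Two consecutive grid points, since the lines at two vertices of a simplex may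
-- differ by one.
Overlap : Pred ℕ ℓ → Pred ℕ ℓ → Set ℓ
Overlap H H′ = ∃ λ x → (H x × H (suc x)) × H′ x × H′ (suc x)

-- Points of `H` on both sides of `x` would put `x` into `H` by convexity.
side : ExcludedMiddle ℓ → {H : Pred ℕ ℓ} → Convex H → ∀ {x} → ¬ H x → Below H x ⊎ Above H x
side em {H} convex {x} ¬Hx with em {∃ λ y → H y × y <ᴺ x}
... | yes (y , Hy , y<x) = inj₂ λ z Hz → ≰⇒> λ x≤z → ¬Hx (convex (<⇒≤ y<x) x≤z Hy Hz)
... | no none = inj₁ λ y Hy → ≤∧≢⇒< (≮⇒≥ λ y<x → none (y , Hy , y<x)) λ { refl → ¬Hx Hy }

-- The strip of a set is the first of the lines h 0, …, h (m ∸ 1), in no particular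
-- order, that lies above it, and m if there is none.
Strip : Pred ℕ ℓ → (ℕ → ℕ) → ℕ → ℕ → Set ℓ
Strip H h m r = r <ᴺ suc m × (∀ {i} → i <ᴺ r → Below H (h i)) × (r <ᴺ m → Above H (h r))

strip : ∀ (H : Pred ℕ ℓ) h m → (∀ {i} → i <ᴺ m → Below H (h i) ⊎ Above H (h i)) → ∃ (Strip H h m)
strip H h zero    sides = 0 , z<s , (λ ()) , λ ()
strip H h (suc m) sides with sides z<s
... | inj₂ above = 0 , z<s , (λ ()) , λ _ → above
... | inj₁ below with strip H (h ∘ suc) m (sides ∘ s≤s)
...   | r , r<1+m , belows , above =
  suc r , s≤s r<1+m , (λ { {zero} _ → below ; {suc i} i<r → belows (≤-pred i<r) }) , above ∘ ≤-pred

strip-sides : ∀ {H : Pred ℕ ℓ} {N h m r x} → Strip H h m r → H x → x ≤ N →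
  ∀ {i} → i <ᴺ m → Sides N (h i) i r
strip-sides {h = h} {r = r} {x} (_ , belows , above) Hx x≤N {i} i<m =
  (λ hi≡0 → λ { refl → n≮0 (subst (x <ᴺ_) hi≡0 (above i<m x Hx)) }) ,
  (λ hi≡N → ≮⇒≥ λ i<r → <⇒≱ (subst (_<ᴺ x) hi≡N (belows i<r x Hx)) x≤N)

-- If `r < r′`, line `r` is beyond `suc x` at the first vertex, being above `H`, and before `x` at
-- the second, being below `H′`; but it moves by at most one.
strips-apart : ∀ {h h′ m r r′} {H H′ : Pred ℕ ℓ} →
  (∀ i → h i ≤ suc (h′ i)) → (∀ i → h′ i ≤ suc (h i)) →
  Strip H h m r → Strip H′ h′ m r′ → r ≢ r′ → ¬ Overlap H H′
strips-apart {r = r} {r′} near near′ (r<1+m , belows , above) (r′<1+m , belows′ , above′) r≢r′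
  (x , (Hx , Hsx) , H′x , H′sx) with <-cmp r r′
... | tri< r<r′ _ _ = <-asym (belows′ r<r′ x H′x)
        (≤-pred (≤-trans (above (≤-trans r<r′ (≤-pred r′<1+m)) (suc x) Hsx) (near r)))
... | tri≈ _ r≡r′ _ = r≢r′ r≡r′
... | tri> _ _ r′<r = <-asym (belows r′<r x Hx)
        (≤-pred (≤-trans (above′ (≤-trans r′<r (≤-pred r<1+m)) (suc x) H′sx) (near′ r′)))

-- From a good simplex to a separated subfamily.

lookup-distinct : ∀ {A : Set} {f : A → ℕ} {W} → Unique (map f W) →
  ∀ i j → i ≢ j → f (List.lookup W i) ≢ f (List.lookup W j)
lookup-distinct {W = _ ∷ _} _ Fin.zero Fin.zero i≢j = contradiction refl i≢j
lookup-distinct {f = f} {_ ∷ W} (f≢ ∷ _) Fin.zero (Fin.suc j) _ =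
  All.lookup f≢ (∈-map⁺ f (∈-lookup j))
lookup-distinct {f = f} {_ ∷ W} (f≢ ∷ _) (Fin.suc i) Fin.zero _ =
  All.lookup f≢ (∈-map⁺ f (∈-lookup i)) ∘ sym
lookup-distinct {W = _ ∷ W} (_ ∷ unique) (Fin.suc i) (Fin.suc j) i≢j =
  lookup-distinct unique i j (i≢j ∘ cong Fin.suc)

multiplicity : ℕ → List ℕ → ℕ
multiplicity c = length ∘ filter (_≟ c)

fibre-multiplicity : ∀ {A : Set} {n} (f : A → Fin n) W c →
  ∣ fibre (f ∘ List.lookup W) c ∣ ≡ multiplicity (toℕ c) (map (toℕ ∘ f) W)
fibre-multiplicity f []      c = refl
fibre-multiplicity f (w ∷ W) c with f w Finₚ.≟ c | toℕ (f w) ≟ toℕ c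
... | yes fw≡c | yes eq rewrite dec-true (toℕ (f w) ≟ toℕ c) eq = cong suc (fibre-multiplicity f W c)
... | no fw≢c  | no neq rewrite dec-false (toℕ (f w) ≟ toℕ c) neq = fibre-multiplicity f W c
... | yes fw≡c | no neq = contradiction (cong toℕ fw≡c) neq
... | no fw≢c  | yes eq = contradiction (Finₚ.toℕ-injective eq) fw≢c

module _ (em : ∀ ℓ → ExcludedMiddle ℓ) {N k} {Hy Hx : Fin k → Pred ℕ ℓ}
  (convexʸ : ∀ j → Convex (Hy j)) (convexˣ : ∀ j → Convex (Hx j))
  (reachʸ : ∀ j → ∃ λ x → Hy j x × x ≤ N) (reachˣ : ∀ j → ∃ λ x → Hx j x × x ≤ N)
  where

  Separated : ∀ n → List ℕ → ℕ → Set ℓ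
  Separated n K l = ∃₂ λ (X : Fin l → Fin k) (σ : Fin l → Fin (suc n)) →
    (∀ c → ∣ fibre σ c ∣ ≡ multiplicity (toℕ c) K) ×
    (∀ i j → i ≢ j → ¬ Overlap (Hy (X i)) (Hy (X j))) ×
    (∀ i j → σ i ≢ σ j → ¬ Overlap (Hx (X i)) (Hx (X j)))

  module _ (n : ℕ) (L : List ℕ)
    (uncut : ∀ (h w : ℕ → ℕ) → ∃ λ j →
      (∀ {i} → i <ᴺ length L → ¬ Hy j (h i)) × (∀ {i} → i <ᴺ n → ¬ Hx j (w i)))
    where

    m = length L

    module _ (v : Vec ℕ (m + n)) where

      h w : ℕ → ℕ
      h i = at v (i + n)
      w = at v

      chosen = uncut h w

      stripʸ : ∃ (Strip (Hy (proj₁ chosen)) h m)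
      stripʸ = strip _ h m λ i<m → side (em _) (convexʸ _) (proj₁ (proj₂ chosen) i<m)

      stripˣ : ∃ (Strip (Hx (proj₁ chosen)) w n)
      stripˣ = strip _ w n λ i<n → side (em _) (convexˣ _) (proj₂ (proj₂ chosen) i<n)

      lab : Label
      lab = proj₁ stripʸ , proj₁ stripˣ

    labelling : GridLabelling N n m lab
    labelling v =
      let (j , _) = chosen v
          (_ , stripR) = stripʸ v
          (_ , stripC) = stripˣ v
          (_ , hitʸ , ≤ʸ) = reachʸ j
          (_ , hitˣ , ≤ˣ) = reachˣ j
      in (proj₁ stripR , proj₁ stripC) , strip-sides stripC hitˣ ≤ˣ , strip-sides stripR hitʸ ≤ʸ

    colour : Vec ℕ (m + n) → Fin (suc n)
    colour v = fromℕ< (proj₁ (proj₂ (stripˣ v)))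

    toℕ-colour : ∀ v → toℕ (colour v) ≡ col (lab v)
    toℕ-colour v = Finₚ.toℕ-fromℕ< (proj₁ (proj₂ (stripˣ v)))

    -- The rows in a good simplex are pairwise distinct and the colours are its columns, so
    -- `strips-apart` applies in both directions; any two of its vertices are close because both are
    -- near `v`.
    separated : ∀ ρ → All (_<ᴺ suc n) (ρ ∷ L) → Separated n (ρ ∷ L) (suc m)
    separated ρ ρL< with sperner (em 0ℓ) N n ρ L ρL< lab labelling
    ... | v , W , near , rows≡ , cols↭ = subst (Separated n (ρ ∷ L))
      (trans (sym (length-map (row ∘ lab) W)) (trans (cong length rows≡) (length-downFrom (suc m))))
      ( proj₁ ∘ chosen ∘ List.lookup W , colour ∘ List.lookup W
      , (λ c → trans (fibre-multiplicity colour W c)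
          (trans (cong (multiplicity (toℕ c)) (map-cong toℕ-colour W))
            (↭-length (filter-↭ (_≟ toℕ c) cols↭))))
      , (λ i j i≢j → strips-apart (close i j ∘ (_+ n)) (close j i ∘ (_+ n))
          (proj₂ (stripʸ (List.lookup W i))) (proj₂ (stripʸ (List.lookup W j)))
          (lookup-distinct (subst Unique (sym rows≡) (downFrom⁺ (suc m))) i j i≢j))
      , (λ i j σi≢σj → strips-apart (close i j) (close j i)
          (proj₂ (stripˣ (List.lookup W i))) (proj₂ (stripˣ (List.lookup W j)))
          (σi≢σj ∘ λ eq → Finₚ.toℕ-injective
            (trans (toℕ-colour (List.lookup W i)) (trans eq (sym (toℕ-colour (List.lookup W j))))))) )
      where
      close : ∀ i j e → at (List.lookup W i) e ≤ suc (at (List.lookup W j) e)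
      close i j e = ≤-trans (proj₂ (All.lookup near (∈-lookup i) e))
        (s≤s (proj₁ (All.lookup near (∈-lookup j) e)))

-- Degree sequences as lists with repetitions.

palette : ∀ {k} → Vec ℕ k → List ℕ
palette []       = []
palette (a ∷ as) = replicate a 0 ++ map suc (palette as)

length-palette : ∀ {k} (as : Vec ℕ k) → length (palette as) ≡ sum as
length-palette []       = refl
length-palette (a ∷ as) = trans (length-++ (replicate a 0))
  (cong₂ _+_ (length-replicate a) (trans (length-map suc (palette as)) (length-palette as)))

palette-< : ∀ {k} (as : Vec ℕ k) → All (_<ᴺ k) (palette as)
palette-< []       = []
palette-< (a ∷ as) = All-++⁺ (All-replicate⁺ a z<s) (All-map⁺ (All.map s≤s (palette-< as)))

multiplicity-palette : ∀ {k} (as : Vec ℕ k) c → multiplicity (toℕ c) (palette as) ≡ lookup as c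
multiplicity-palette (a ∷ as) c = trans
  (trans (cong length (filter-++ (_≟ toℕ c) (replicate a 0) _))
         (length-++ (filter (_≟ toℕ c) (replicate a 0))))
  (go c)
  where
  shifted : ∀ j L → multiplicity (suc j) (map suc L) ≡ multiplicity j L
  shifted j []      = refl
  shifted j (i ∷ L) with i ≟ j
  ... | yes i≡j rewrite dec-true (i ≟ j) i≡j = cong suc (shifted j L)
  ... | no i≢j rewrite dec-false (i ≟ j) i≢j = shifted j L
  go : ∀ c → multiplicity (toℕ c) (replicate a 0) + multiplicity (toℕ c) (map suc (palette as)) ≡
    lookup (a ∷ as) c
  go Fin.zero = trans (cong₂ _+_
    (trans (cong length (filter-all (_≟ 0) (All-replicate⁺ a refl))) (length-replicate a))
    (cong length (filter-none (_≟ 0) {xs = map suc (palette as)} (All-map⁺ (All.universal (λ _ ()) _)))))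
    (+-identityʳ a)
  go (Fin.suc c) = cong₂ _+_
    (cong length (filter-none (_≟ suc (toℕ c)) (All-replicate⁺ a λ ())))
    (trans (shifted (toℕ c) (palette as)) (multiplicity-palette as c))

-- Finite grids of rational positions.

Monotone : (ℕ → ℚ) → Set
Monotone pos = ∀ {x y} → x ≤ y → pos x ℚ.≤ pos y

grid : ∀ L → ∃₂ λ N pos → Monotone pos × ∀ {q} → q ∈ L → ∃ λ x → x ≤ N × pos x ≡ q
grid L with enumerate (sort L) (Linked⇒AllPairs ℚₚ.≤-trans (sort-↗ L))
  where
  enumerate : ∀ L → AllPairs ℚ._≤_ L →
    ∃₂ λ N pos → Monotone pos × ∀ {q} → q ∈ L → ∃ λ x → x ≤ N × pos x ≡ q
  enumerate []      _                = 0 , (λ _ → 0ℚ) , (λ _ → ℚₚ.≤-refl) , λ ()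
  enumerate (r ∷ L) (r≤ ∷ sorted) with enumerate L sorted
  ... | N , pos , mono , hit = suc N , pos′ , mono′ , hit′
    where
    pos′ : ℕ → ℚ
    pos′ zero    = r
    -- The maximum makes `pos′` monotone even past the listed points, where the default `0ℚ` enters;
    -- it fixes the listed ones since `L` is sorted.
    pos′ (suc x) = r ⊔ pos x
    mono′ : Monotone pos′
    mono′ {zero}  {zero}  _         = ℚₚ.≤-refl
    mono′ {zero}  {suc y} _         = ℚₚ.p≤p⊔q r (pos y)
    mono′ {suc x} {suc y} (s≤s x≤y) = ℚₚ.⊔-monoʳ-≤ r (mono x≤y)
    hit′ : ∀ {q} → q ∈ r ∷ L → ∃ λ x → x ≤ suc N × pos′ x ≡ q
    hit′ (here refl) = 0 , z≤n , refl
    hit′ (there q∈L) with hit q∈L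
    ... | x , x≤N , refl = suc x , s≤s x≤N , ℚₚ.p≤q⇒p⊔q≡q (All.lookup r≤ q∈L)
... | N , pos , mono , hit = N , pos , mono , hit ∘ ∈-resp-↭ (↭-sym (sort-↭ L))

-- Rational lines, half-planes and projections of open sets.

ι : ℚ → ℝ
ι q = record
  { lower     = ℚ._< q
  ; inhabited = q ℚ.+ ℚ.- 1ℚ , subst (q ℚ.+ ℚ.- 1ℚ ℚ.<_) (ℚₚ.+-identityʳ q)
                  (ℚₚ.+-monoʳ-< q (ℚₚ.negative⁻¹ (ℚ.- 1ℚ)))
  ; proper    = q , ℚₚ.<-irrefl refl
  ; closed    = ℚₚ.<-trans
  ; rounded   = ℚₚ.<-dense
  }

p<p+1 : ∀ p → p ℚ.< p ℚ.+ 1ℚ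
p<p+1 p = subst (ℚ._< p ℚ.+ 1ℚ) (ℚₚ.+-identityʳ p) (ℚₚ.+-monoʳ-< p (ℚₚ.positive⁻¹ 1ℚ))

smaller : ∀ x → ∃ λ y → y < x
smaller x = let p , p∈x = inhabited x in ι p , p , p∈x , ℚₚ.<-irrefl refl

larger : ∀ x → ∃ λ y → x < y
-- Since `x` may equal `ι p`, one is added.
larger x = let p , p∉x = proper x in ι (p ℚ.+ 1ℚ) , p , p<p+1 p , p∉x

≤∧≢⇒<ℚ : ∀ {p q} → p ℚ.≤ q → p ≢ q → p ℚ.< q
≤∧≢⇒<ℚ p≤q p≢q = ℚₚ.≰⇒> λ q≤p → p≢q (ℚₚ.≤-antisym p≤q q≤p)

closed-≤ : ∀ x {p q} → p ℚ.≤ q → lower x q → lower x p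
closed-≤ x {p} {q} p≤q q∈x with p ℚₚ.≟ q
... | yes refl = q∈x
... | no p≢q = closed x (≤∧≢⇒<ℚ p≤q p≢q) q∈x

<ℝ-asym : ∀ {x y} → x < y → ¬ (y < x)
<ℝ-asym {x} {y} (p , p∈y , p∉x) (q , q∈x , q∉y) with p ℚₚ.≤? q
... | yes p≤q = p∉x (closed-≤ x p≤q q∈x)
... | no p≰q = q∉y (closed-≤ y (ℚₚ.<⇒≤ (ℚₚ.≰⇒> p≰q)) p∈y)

Hit : PlaneSet → Pred ℚ _
Hit S q = S ≬ horizontalLine (ι q)

under over : ℝ → PlaneSet
under c (_ , y) = Lift _ (y < c)
over  c (_ , y) = Lift _ (c < y)

under-open : ∀ c → IsOpen (under c)
under-open c {x , y} (lift y<c) =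
  let a , a<x = smaller x ; b , x<b = larger x ; d , d<y = smaller y in
  (a , d) , (b , c) , ((a<x , x<b) , d<y , y<c) , λ (_ , _ , y<c) → lift y<c

over-open : ∀ c → IsOpen (over c)
over-open c {x , y} (lift c<y) =
  let a , a<x = smaller x ; b , x<b = larger x ; d , y<d = larger y in
  (a , c) , (b , d) , ((a<x , x<b) , c<y , y<d) , λ (_ , c<y , _) → lift c<y

-- Exchanging the axes carries results on horizontal lines over to vertical ones.
transpose : PlaneSet → PlaneSet
transpose S = S ∘ ×-swap

transpose-open : ∀ {S} → IsOpen S → IsOpen (transpose S)
transpose-open openS S∋ with openS S∋
... | (a , c) , (b , d) , (∈x , ∈y) , ⊆S = (c , a) , (d , b) , (∈y , ∈x) , λ (∈y , ∈x) → ⊆S (∈x , ∈y)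

transpose-connected : ∀ {S} → IsConnected S → IsConnected (transpose S)
transpose-connected ((p , p∈S) , connected) = (×-swap p , p∈S) ,
  λ U V openU openV cover (u , u∈S , u∈U) (v , v∈S , v∈V) empty →
    connected (transpose U) (transpose V) (transpose-open openU) (transpose-open openV) cover
      (×-swap u , u∈S , u∈U) (×-swap v , v∈S , v∈V) (empty ∘ ×-swap)

Meet : Pred ℚ ℓ → Pred ℚ ℓ → Set ℓ
Meet H H′ = ∃₂ λ p q → p ℚ.< q × (H p × H q) × (H′ p × H′ q)

-- Open boxes in `S` and `T` around points of the same height `y` share all rational heights
-- slightly below `y`.
yProjection-meet : ∀ {S T} → IsOpen S → IsOpen T →
  yProjection S ≬ yProjection T → Meet (Hit S) (Hit T)
yProjection-meet {S} {T} openS openT (y , (x , xy∈S) , (x′ , xy∈T)) with openS xy∈S | openT xy∈T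
... | (a , c) , (b , d) , ((a<x , x<b) , (s , s∈y , s∉c) , (u , u∈d , u∉y)) , ⊆S
    | (a′ , c′) , (b′ , d′) , ((a′<x , x<b′) , (s′ , s′∈y , s′∉c′) , (u′ , u′∈d′ , u′∉y)) , ⊆T =
  let e , s≤e , s′≤e , e∈y = upper
      p , e<p , p∈y = rounded y e∈y
      q , p<q , q∈y = rounded y p∈y
      hit : ∀ {r} → e ℚ.< r → lower y r → Hit S r × Hit T r
      hit {r} e<r r∈y =
        ((x , ι r) , ⊆S ((a<x , x<b) , (s , ℚₚ.≤-<-trans s≤e e<r , s∉c) , (u , u∈d , beyond u∉y r∈y)) ,
         lift (id , id)) ,
        ((x′ , ι r) , ⊆T ((a′<x , x<b′) ,
          (s′ , ℚₚ.≤-<-trans s′≤e e<r , s′∉c′) , (u′ , u′∈d′ , beyond u′∉y r∈y)) ,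
         lift (id , id))
      hitp = hit e<p p∈y
      hitq = hit (ℚₚ.<-trans e<p p<q) q∈y
  in p , q , p<q , (proj₁ hitp , proj₁ hitq) , (proj₂ hitp , proj₂ hitq)
  where
  upper : ∃ λ e → s ℚ.≤ e × s′ ℚ.≤ e × lower y e
  upper with ℚₚ.≤-total s s′
  ... | inj₁ s≤s′ = s′ , s≤s′ , ℚₚ.≤-refl , s′∈y
  ... | inj₂ s′≤s = s , ℚₚ.≤-refl , s′≤s , s∈y
  beyond : ∀ {u r} → ¬ lower y u → lower y r → ¬ (u ℚ.< r)
  beyond u∉y r∈y u<r = u∉y (closed y u<r r∈y)

Convexℚ : Pred ℚ ℓ → Set ℓ
Convexℚ H = ∀ {p q r} → p ℚ.≤ q → q ℚ.≤ r → H p → H r → H q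

-- Connectedness and the choice of sample points.

module _ (em : ∀ ℓ → ExcludedMiddle ℓ) where

  <ℝ-cmp : ∀ x y → x < y ⊎ x ≈ y ⊎ y < x
  <ℝ-cmp x y with em 0ℓ {x < y} | em 0ℓ {y < x}
  ... | yes x<y | _       = inj₁ x<y
  ... | no _    | yes y<x = inj₂ (inj₂ y<x)
  ... | no x≮y  | no y≮x  = inj₂ (inj₁
    ( (λ {q} q∈x → decidable-stable (em 0ℓ) λ q∉y → y≮x (q , q∈x , q∉y))
    , (λ {q} q∈y → decidable-stable (em 0ℓ) λ q∉x → x≮y (q , q∈y , q∉x))))

  -- A line at `q` that missed `S` would leave it in two disjoint open half-planes, both of which it
  -- meets.
  hit-convex : ∀ {S} → IsConnected S → ∀ {p q r} → p ℚ.≤ q → q ℚ.≤ r → Hit S p → Hit S r → Hit S q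
  hit-convex {S} (_ , connected) {p} {q} {r} p≤q q≤r
    hitp@((x , y) , xy∈S , lift y≈p) hitr@((x′ , y′) , xy′∈S , lift y′≈r)
    with em _ {Hit S q} | p ℚₚ.≟ q | q ℚₚ.≟ r
  ... | yes hitq | _        | _        = hitq
  ... | no _     | yes refl | _        = hitp
  ... | no _     | no _     | yes refl = hitr
  ... | no ¬hitq | no p≢q   | no q≢r   = contradiction
    (λ { (x , y) (_ , lift y<q , lift q<y) → <ℝ-asym {y} {ι q} y<q q<y })
    (connected (under (ι q)) (over (ι q))
      (λ {p} → under-open (ι q) {p}) (λ {p} → over-open (ι q) {p}) (λ {p} → cover {p})
      ((x , y) , xy∈S , lift (p , ≤∧≢⇒<ℚ p≤q p≢q , λ p∈y → ℚₚ.<-irrefl refl (proj₁ y≈p p∈y)))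
      ((x′ , y′) , xy′∈S , lift (q , proj₂ y′≈r (≤∧≢⇒<ℚ q≤r q≢r) , ℚₚ.<-irrefl refl)))
    where
    cover : ∀ {p} → S p → (under (ι q) ∪ over (ι q)) p
    cover {x , y} xy∈S with <ℝ-cmp y (ι q)
    ... | inj₁ y<q        = inj₁ (lift y<q)
    ... | inj₂ (inj₁ y≈q) = contradiction ((x , y) , xy∈S , lift y≈q) ¬hitq
    ... | inj₂ (inj₂ q<y) = inj₂ (lift q<y)

  meetingPoints : Pred ℚ ℓ → Pred ℚ ℓ → List ℚ
  meetingPoints H H′ with em _ {Meet H H′}
  ... | yes (p , q , _) = p ∷ q ∷ []
  ... | no _            = []

  meetingPoints-∋ : {H H′ : Pred ℚ ℓ} → Meet H H′ → ∃₂ λ p q →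
    p ∈ meetingPoints H H′ × q ∈ meetingPoints H H′ × p ℚ.< q × (H p × H q) × (H′ p × H′ q)
  meetingPoints-∋ {H = H} {H′} meet with em _ {Meet H H′}
  ... | yes (p , q , m) = p , q , here refl , there (here refl) , m
  ... | no ¬meet        = contradiction meet ¬meet

  samples : ∀ {k} → (Fin k → Pred ℚ ℓ) → List ℚ
  samples {k = k} H =
    concatMap (λ i → concatMap (λ j → meetingPoints (H i) (H j)) (allFin k)) (allFin k)

  samples-∋ : ∀ {k} {H : Fin k → Pred ℚ ℓ} i j {q} → q ∈ meetingPoints (H i) (H j) → q ∈ samples H
  samples-∋ i j q∈ = ∈-concatMap⁺ _ (lose (∈-allFin i) (∈-concatMap⁺ _ (lose (∈-allFin j) q∈)))

  module _ {pos : ℕ → ℚ} (mono : Monotone pos) {N} {k} {H : Fin k → Pred ℚ ℓ}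
    (convex : ∀ j → Convexℚ (H j)) (hit : ∀ {q} → q ∈ samples H → ∃ λ x → x ≤ N × pos x ≡ q) where

    -- The two sample points `p` and `q` are on the grid and `p < q`, so the grid point that follows
    -- `p` lies between them and convexity applies.
    meet-overlap : ∀ i j → Meet (H i) (H j) →
      ∃ λ x → ((H i (pos x) × H i (pos (suc x))) × H j (pos x) × H j (pos (suc x))) × x ≤ N
    meet-overlap i j meet with meetingPoints-∋ meet
    ... | p , q , p∈ , q∈ , p<q , (Hip , Hiq) , (Hjp , Hjq)
      with hit (samples-∋ i j p∈) | hit (samples-∋ i j q∈)
    ... | x , x≤N , refl | y , _ , refl =
      x , ((Hip , convex i p≤ ≤q Hip Hiq) , Hjp , convex j p≤ ≤q Hjp Hjq) , x≤N
      where
      p≤ : pos x ℚ.≤ pos (suc x)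
      p≤ = mono (n≤1+n x)
      ≤q : pos (suc x) ℚ.≤ pos y
      ≤q = mono (≰⇒> λ y≤x → ℚₚ.<-irrefl refl (ℚₚ.<-≤-trans p<q (mono y≤x)))

  module _ {k} {Hy Hx : Fin k → Pred ℚ ℓ}
    (convexʸ : ∀ j → Convexℚ (Hy j)) (convexˣ : ∀ j → Convexℚ (Hx j))
    (meetʸ : ∀ j → Meet (Hy j) (Hy j)) (meetˣ : ∀ j → Meet (Hx j) (Hx j)) where

    separatedℚ : ∀ n m (C : List ℕ) → All (_<ᴺ suc n) C → length C ≡ suc m →
      (∀ (h w : ℕ → ℚ) → ∃ λ j →
        (∀ {i} → i <ᴺ m → ¬ Hy j (h i)) × (∀ {i} → i <ᴺ n → ¬ Hx j (w i))) →
      ∃₂ λ (X : Fin (suc m) → Fin k) (σ : Fin (suc m) → Fin (suc n)) →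
        (∀ c → ∣ fibre σ c ∣ ≡ multiplicity (toℕ c) C) ×
        (∀ i j → i ≢ j → ¬ Meet (Hy (X i)) (Hy (X j))) ×
        (∀ i j → σ i ≢ σ j → ¬ Meet (Hx (X i)) (Hx (X j)))
    -- The entry `ρ` is split off as the root column; the `m` entries of `L` correspond to the
    -- horizontal lines.
    separatedℚ n m (ρ ∷ L) C< refl uncut with grid (samples Hy ++ samples Hx)
    ... | N , pos , mono , hit =
      let X , σ , sizes , apartʸ , apartˣ =
            separated em {N = N} {Hy = λ j → Hy j ∘ pos} {λ j → Hx j ∘ pos}
            (λ j x≤y y≤z → convexʸ j (mono x≤y) (mono y≤z))
            (λ j x≤y y≤z → convexˣ j (mono x≤y) (mono y≤z))
            -- A set meets itself, so the samples contain a grid point at which it is hit.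
            (λ j → let z , ((hits , _) , _) , z≤N = overlapʸ j j (meetʸ j) in z , hits , z≤N)
            (λ j → let z , ((hits , _) , _) , z≤N = overlapˣ j j (meetˣ j) in z , hits , z≤N)
            n L (λ h w → uncut (pos ∘ h) (pos ∘ w)) ρ C<
      in X , σ , sizes ,
        (λ i j i≢j meet → apartʸ i j i≢j (let z , o , _ = overlapʸ (X i) (X j) meet in z , o)) ,
        (λ i j σi≢σj meet → apartˣ i j σi≢σj (let z , o , _ = overlapˣ (X i) (X j) meet in z , o))
      where
      overlapʸ = meet-overlap {pos = pos} mono {N = N} {H = Hy} convexʸ (hit ∘ ∈-++⁺ˡ)
      overlapˣ = meet-overlap {pos = pos} mono {N = N} {H = Hx} convexˣ (hit ∘ ∈-++⁺ʳ (samples Hy))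

-- The alternative for families of plane sets.

corollary4 :
    (∀ ℓ → ExcludedMiddle ℓ) →
    ∀ {k} (𝓕 : Fin k → PlaneSet) →
    (∀ j → IsConnected (𝓕 j)) →
    (∀ j → IsBounded (𝓕 j)) →
    (∀ j → IsOpen (𝓕 j)) →
    ∀ (n m : ℕ) → 0 <ᴺ n → n ≤ m →
    (∃₂ λ (h : Fin m → ℝ) (v : Fin n → ℝ) →
       [ horizontalLine ∘ h , verticalLine ∘ v ]′ Cuts 𝓕)
    ⊎
    (∀ (a : Vec ℕ (suc n)) → (∀ i → 0 <ᴺ lookup a i) → sum a ≡ suc m →
       ∃₂ λ (X : Fin (suc m) → Fin k) (σ : Fin (suc m) → Fin (suc n)) →
         (∀ i → ∣ fibre σ i ∣ ≡ lookup a i) ×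
         (∀ i j → i ≢ j →
            yProjection (𝓕 (X i)) ⊥ yProjection (𝓕 (X j))) ×
         (∀ i j → σ i ≢ σ j →
            xProjection (𝓕 (X i)) ⊥ xProjection (𝓕 (X j))))
corollary4 em {k} 𝓕 connected _ open′ n m _ _ with em _
... | yes cut = inj₁ cut
... | no ¬cut = inj₂ λ a _ sum-a →
  let X , σ , sizes , apartʸ , apartˣ = separatedℚ em {Hy = Hy} {Hx} convexʸ convexˣ
        (λ j → let ((x , y) , p∈) = proj₁ (connected j) in meetʸ j j (y , (x , p∈) , (x , p∈)))
        (λ j → let ((x , y) , p∈) = proj₁ (connected j) in meetˣ j j (x , (y , p∈) , (y , p∈)))
        n m (palette a) (palette-< a) (trans (length-palette a) sum-a) uncut
  in X , σ , (λ c → trans (sizes c) (multiplicity-palette a c)) ,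
     (λ i j i≢j y∈ → apartʸ i j i≢j (meetʸ (X i) (X j) (_ , y∈))) ,
     (λ i j σi≢σj x∈ → apartˣ i j σi≢σj (meetˣ (X i) (X j) (_ , x∈)))
  where
  Hy Hx : Fin k → Pred ℚ _
  Hy j = Hit (𝓕 j)
  Hx j = Hit (transpose (𝓕 j))

  convexʸ : ∀ j → Convexℚ (Hy j)
  convexʸ j = hit-convex em (connected j)
  convexˣ : ∀ j → Convexℚ (Hx j)
  convexˣ j = hit-convex em (transpose-connected (connected j))

  meetʸ : ∀ i j → yProjection (𝓕 i) ≬ yProjection (𝓕 j) → Meet (Hy i) (Hy j)
  meetʸ i j = yProjection-meet (open′ i) (open′ j)
  meetˣ : ∀ i j → xProjection (𝓕 i) ≬ xProjection (𝓕 j) → Meet (Hx i) (Hx j)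
  meetˣ i j = yProjection-meet (transpose-open (open′ i)) (transpose-open (open′ j))

  Misses : (h w : ℕ → ℚ) → Fin k → Set _
  Misses h w j = (∀ {i} → i <ᴺ m → ¬ Hy j (h i)) × (∀ {i} → i <ᴺ n → ¬ Hx j (w i))

  uncut : ∀ h w → ∃ (Misses h w)
  uncut h w = missed (em _)
    where
    lines : Fin m ⊎ Fin n → PlaneSet
    lines = [ horizontalLine ∘ (ι ∘ h ∘ toℕ) , verticalLine ∘ (ι ∘ w ∘ toℕ) ]′
    missed : Dec (∃ λ j → ∀ l → ¬ (𝓕 j ≬ lines l)) → ∃ (Misses h w)
    missed (yes (j , miss)) = j ,
      (λ i<m hits → miss (inj₁ (fromℕ< i<m))
        (subst (λ i → Hy j (h i)) (sym (Finₚ.toℕ-fromℕ< i<m)) hits)) ,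
      (λ {i} i<n (p , p∈ , on) → miss (inj₂ (fromℕ< i<n))
        (×-swap p , p∈ , subst (λ i → verticalLine (ι (w i)) (×-swap p)) (sym (Finₚ.toℕ-fromℕ< i<n)) on))
    -- If no set were missed, these rational lines would cut `𝓕`.
    missed (no ¬miss) = contradiction
      (ι ∘ h ∘ toℕ , ι ∘ w ∘ toℕ , λ j →
        decidable-stable (em _) λ ¬hits → ¬miss (j , λ l on → ¬hits (l , on)))
      ¬cut
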